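{- For every integer $n\ge 3$, $$|\mathcal{M}_1(P(n))|=\begin{cases}2 & \text{if } n=4,\\[4pt] \displaystyle\sum_{\substack{0\le l\le n\\ n-l\equiv 0\ (\mathrm{mod}\ 4)}} \frac{n}{\,l+\frac{n-l}{4}\,}\binom{l+\frac{n-l}{4}}{l} & \text{otherwise.}\end{cases}$$
   Context: For $n\ge 3$, $P(n)=P(n,2)$ is the simple graph with vertex set $\{u_i,v_i:0\le i\le n-1\}$ and edge set $\{u_iu_{i+2},\,u_iv_i,\,v_iv_{i+1}:0\le i\le n-1\}$, subscripts modulo $n$. The edges $u_iv_i$ are called spokes. For $n\neq 4$, $\mathcal{M}_1(P(n))$ is the set of perfect matchings $M$ of $P(n)$ such that either (i) $M$ contains at least one spoke, and for any two (cyclically) consecutive spokes $u_iv_i,u_jv_j$ of $M$ the number of spokes $u_kv_k$ of $P(n)$ strictly between them, $j-i-1$ (with $j$ taken as the representative in $(i,i+n]$), is $\equiv 0\pmod 4$ (if $M$ has exactly one spoke $u_iv_i$, it is regarded as two consecutive spokes with $j=i+n$, so the number is $n-1$); or (ii) $M$ contains no spoke, $4\mid n$, and for some $i$, $M=\bigcup_{k=0}^{n/4-1}\{u_{i+4k}u_{i+4k+2},\,u_{i+4k+1}u_{i+4k+3},\,v_{i+4k}v_{i+4k+1},\,v_{i+4k+2}v_{i+4k+3}\}$. For $n=4$, $\mathcal{M}_1(P(4))$ consists of the two perfect matchings $\{u_iv_i:0\le i\le 3\}$ and $\{u_0u_2,u_1u_3,v_0v_1,v_2v_3\}$. -}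

module Defs where

open import Data.Bool.Base using (Bool; T)
open import Data.Fin.Base using (Fin; toℕ)
open import Data.Fin.Properties using (toℕ-fromℕ<)
open import Data.Integer.Base using (+_)
open import Data.List.Base using (List; []; _∷_; map; foldr; concatMap; upTo)
open import Data.List.Membership.Propositional using (_∈_)
open import Data.Nat.Base
open import Data.Nat.Combinatorics using (_C_)
open import Data.Nat.Divisibility using (_∣_; _∣?_; divides; ∣m+n∣m⇒∣n; ∣⇒≤)
open import Data.Nat.DivMod using (_/_; _%_; _mod_; m%n<n; m≡m%n+[m/n]*n; m≥n⇒m/n>0)
open import Data.Nat.Properties
open import Data.Product using (_×_; _,_; Σ-syntax; ∃-syntax; ∃!; proj₁)
open import Data.Rational.Base using (ℚ; 0ℚ) renaming (_/_ to _/ℚ_; _+_ to _+ℚ_; _*_ to _*ℚ_)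
open import Data.Sum.Base using (_⊎_; inj₁; inj₂; swap)
open import Function.Base using (_on_)
open import Function.Bundles using (Inverse; _⇔_)
open import Level using (0ℓ)
open import Relation.Binary.Bundles using (Setoid)
open import Relation.Binary.Core using (Rel)
open import Relation.Binary.Definitions using (Symmetric; Irreflexive)
open import Relation.Binary.PropositionalEquality
  using (_≡_; _≢_; refl; sym; trans; cong; setoid; module ≡-Reasoning)
open import Relation.Nullary using (¬_; yes; no)
open import Relation.Nullary.Negation using (contradiction)

HasCardinality : ∀ {a ℓ} → Setoid a ℓ → ℕ → Set _
HasCardinality S N = Inverse S (setoid (Fin N))

record SimpleGraph : Set₁ where
  field
    V           : Set
    Adj         : Rel V 0ℓ
    symmetric   : Symmetric Adj
    irreflexive : Irreflexive _≡_ Adj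

-- A set of edges is encoded as a symmetric Boolean relation on the vertices
-- contained in the adjacency relation.  A vertex is then incident with exactly
-- one edge of the set when it is related to exactly one vertex.
record PerfectMatching (G : SimpleGraph) : Set where
  open SimpleGraph G using (V; Adj)
  field
    edge     : V → V → Bool
    edge-sym : ∀ x y → edge x y ≡ edge y x
    edge⇒Adj : ∀ x y → T (edge x y) → Adj x y
    perfect  : ∀ x → ∃! _≡_ (λ y → T (edge x y))

  -- The edge set is {xy : (x , y) ∈ es}, where xy is an unordered pair.
  EdgeSetIs : List (V × V) → Set
  EdgeSetIs es = ∀ x y → T (edge x y) ⇔ ((x , y) ∈ es ⊎ (y , x) ∈ es)

-- Two perfect matchings are equal when they have the same edges.
_≈ₘ_ : ∀ {G} → Rel (PerfectMatching G) 0ℓ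
M ≈ₘ M′ = ∀ x y → PerfectMatching.edge M x y ≡ PerfectMatching.edge M′ x y

subsetSetoid : ∀ {G} → (PerfectMatching G → Set) → Setoid 0ℓ 0ℓ
subsetSetoid {G} 𝒫 = record
  { Carrier       = Σ[ M ∈ PerfectMatching G ] 𝒫 M
  ; _≈_           = _≈ₘ_ on proj₁
  ; isEquivalence = record
    { refl  = λ x y → refl
    ; sym   = λ p x y → sym (p x y)
    ; trans = λ p q x y → trans (p x y) (q x y)
    }
  }

private
  [i+k]%n≢i%n : ∀ i k n .{{_ : NonZero k}} .{{_ : NonZero n}} → k < n →
                (i + k) % n ≢ i % n
  [i+k]%n≢i%n i k n k<n eq = <⇒≱ k<n (∣⇒≤ (∣m+n∣m⇒∣n
    (divides ((i + k) / n) (+-cancelˡ-≡ (i % n) _ _ lemma)) (divides (i / n) refl)))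
    where
    open ≡-Reasoning
    lemma : i % n + (i / n * n + k) ≡ i % n + (i + k) / n * n
    lemma = begin
      i % n + (i / n * n + k)         ≡⟨ +-assoc (i % n) _ k ⟨
      i % n + i / n * n + k           ≡⟨ cong (_+ k) (m≡m%n+[m/n]*n i n) ⟨
      i + k                           ≡⟨ m≡m%n+[m/n]*n (i + k) n ⟩
      (i + k) % n + (i + k) / n * n   ≡⟨ cong (_+ (i + k) / n * n) eq ⟩
      i % n + (i + k) / n * n         ∎

data Vertex (n : ℕ) : Set where
  u′ v′ : Fin n → Vertex n

module GeneralizedPetersen (n : ℕ) (n≥3 : n ≥ 3) where

  private instance
    n≢0 : NonZero n
    n≢0 = >-nonZero (≤-trans (s≤s z≤n) n≥3)

  -- Subscripts are arbitrary natural numbers, read modulo n; letting them range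
  -- over all of ℕ below gives the same edges and conditions as 0 ≤ i ≤ n - 1.
  u v : ℕ → Vertex n
  u i = u′ (i mod n)
  v i = v′ (i mod n)

  data Edge : Vertex n → Vertex n → Set where
    uu : ∀ i → Edge (u i) (u (i + 2))
    uv : ∀ i → Edge (u i) (v i)
    vv : ∀ i → Edge (v i) (v (i + 1))

  private
    index : Vertex n → ℕ
    index (u′ i) = toℕ i
    index (v′ i) = toℕ i

    shift≢ : ∀ i k .{{_ : NonZero k}} → k < n → toℕ (i mod n) ≢ toℕ ((i + k) mod n)
    shift≢ i k k<n eq = [i+k]%n≢i%n i k n k<n
      (trans (sym (toℕ-fromℕ< (m%n<n (i + k) n)))
             (trans (sym eq) (toℕ-fromℕ< (m%n<n i n))))

    Edge⇒≢ : ∀ {x y} → Edge x y → x ≢ y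
    Edge⇒≢ (uu i) eq = shift≢ i 2 n≥3 (cong index eq)
    Edge⇒≢ (uv i) ()
    Edge⇒≢ (vv i) eq = shift≢ i 1 (≤-trans (s≤s (s≤s z≤n)) n≥3) (cong index eq)

  P : SimpleGraph
  P = record
    { V           = Vertex n
    ; Adj         = λ x y → Edge x y ⊎ Edge y x
    ; symmetric   = swap
    ; irreflexive = λ { x≡y (inj₁ e) → Edge⇒≢ e x≡y
                      ; x≡y (inj₂ e) → Edge⇒≢ e (sym x≡y) }
    }

  module _ (M : PerfectMatching P) where
    open PerfectMatching M

    Spoke : ℕ → Set
    Spoke i = T (edge (u i) (v i))

    -- The spoke at j, with i < j ≤ i + n, is the next spoke of M after that at i.
    -- If M has exactly one spoke, this forces j = i + n.
    Consecutive : ℕ → ℕ → Set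
    Consecutive i j = i < j × j ≤ i + n × Spoke i × Spoke j ×
                      (∀ k → i < k → k < j → ¬ Spoke k)

    SpokesSpacedBy4 : Set
    SpokesSpacedBy4 = (∃[ i ] Spoke i) ×
                      (∀ i j → Consecutive i j → 4 ∣ (j ∸ i ∸ 1))

    SpokelessPattern : Set
    SpokelessPattern = (∀ i → ¬ Spoke i) × 4 ∣ n ×
      (∃[ i ] EdgeSetIs (concatMap
        (λ k → (u (i + 4 * k)     , u (i + 4 * k + 2)) ∷
               (u (i + 4 * k + 1) , u (i + 4 * k + 3)) ∷
               (v (i + 4 * k)     , v (i + 4 * k + 1)) ∷
               (v (i + 4 * k + 2) , v (i + 4 * k + 3)) ∷ [])
        (upTo (n / 4))))

    ExceptionalFor4 : Set
    ExceptionalFor4 =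
        EdgeSetIs (map (λ i → (u i , v i)) (upTo 4))
      ⊎ EdgeSetIs ((u 0 , u 2) ∷ (u 1 , u 3) ∷ (v 0 , v 1) ∷ (v 2 , v 3) ∷ [])

    In𝓜₁ : Set
    In𝓜₁ = (n ≢ 4 × (SpokesSpacedBy4 ⊎ SpokelessPattern))
         ⊎ (n ≡ 4 × ExceptionalFor4)

  𝓜₁ : Setoid 0ℓ 0ℓ
  𝓜₁ = subsetSetoid In𝓜₁

  private
    denominator≢0 : ∀ l → 4 ∣ (n ∸ l) → NonZero (l + (n ∸ l) / 4)
    denominator≢0 (suc l) _   = _
    denominator≢0 zero    4∣n = >-nonZero (m≥n⇒m/n>0 (∣⇒≤ 4∣n))

  summand : ℕ → ℚ
  summand l with 4 ∣? (n ∸ l)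
  ... | no  _     = 0ℚ
  ... | yes 4∣n∸l = _/ℚ_ (+ n) (l + (n ∸ l) / 4) {{denominator≢0 l 4∣n∸l}}
                    *ℚ (+ ((l + (n ∸ l) / 4) C l) /ℚ 1)

  formula : ℚ
  formula with n ≟ 4
  ... | yes _ = + 2 /ℚ 1
  ... | no  _ = foldr _+ℚ_ 0ℚ (map summand (upTo (suc n)))

open GeneralizedPetersen public using (𝓜₁; formula)

{-# OPTIONS --safe #-}
module Submission where

-- For n ≠ 4 the matchings in 𝓜₁ are those given by the tilings of the n-cycle of
-- subscripts with single cells, which are spokes, and blocks i, i+1, i+2, i+3, which
-- carry the edges uᵢuᵢ₊₂, uᵢ₊₁uᵢ₊₃, vᵢvᵢ₊₁, vᵢ₊₂vᵢ₊₃.  That a gap of 4k cells between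
-- spokes can only be filled by k blocks is seen by propagating from the spokes: going
-- forwards determines all edges vᵢvᵢ₊₁ and the second edge uᵢ₊₁uᵢ₊₃ of each block,
-- going backwards determines the first edge uᵢuᵢ₊₂.
--
-- With c(m, l) = C(l+m, l) the number of path tilings with m blocks and l single
-- cells, there are c(m, l) + 3 c(m-1, l) cyclic ones: either a tile begins at 0, or one
-- of the last three cells of a block lies at 0.  This is n/(l+m) C(l+m, l) for
-- n = l + 4m, because m C(l+m, l) = (l+m) C(l+m-1, l).

open import Defs
open import Data.Bool.Base using (Bool; true; false; T)
open import Data.Empty using (⊥-elim)
open import Data.Fin.Base using (Fin; suc; toℕ)
open import Data.Fin.Patterns using (0F; 1F; 2F; 3F)
open import Data.Fin.Properties using (+↔⊎; *↔×; toℕ-fromℕ<; toℕ-injective; toℕ<n) renaming (_≟_ to _≟ᶠ_)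
import Data.Integer.Base as ℤ
import Data.Integer.Properties as ℤ
open import Data.List.Base using (List; []; _∷_; foldr; map; concatMap; upTo; applyUpTo)
open import Data.List.Membership.Propositional using (_∈_; find; lose)
open import Data.List.Membership.Propositional.Properties using (∈-concatMap⁺; ∈-concatMap⁻; ∈-upTo⁺)
open import Data.List.Properties using (map-upTo)
open import Data.List.Relation.Unary.Any using (here; there)
open import Data.Nat.Base hiding (_/_)
open import Data.Nat.Combinatorics using (_C_; nCk+nC[k+1]≡[n+1]C[k+1]; nCn≡1)
open import Data.Nat.Divisibility using (_∣_; _∣?_; divides; _∣0; ∣⇒≤; m%n≡0⇒n∣m)
open import Data.Nat.DivMod
  using (_%_; _mod_; m%n<n; m≡m%n+[m/n]*n; m<n⇒m%n≡m; n%n≡0; m%n%n≡m%n; [m+n]%n≡m%n; [m+kn]%n≡m%n;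
         %-distribˡ-+; m*n/n≡m; m<n*o⇒m/o<n)
  renaming (_/_ to _div_)
open import Data.Nat.Properties
open import Algebra.Properties.CommutativeSemigroup +-commutativeSemigroup
  using (interchange; x∙yz≈y∙xz; x∙yz≈xz∙y; x∙yz≈zx∙y; xy∙z≈x∙zy; xy∙z≈xz∙y)
open import Data.Nat.Tactic.RingSolver using (solve-∀)
open import Data.Product using (_×_; _,_; ∃-syntax; proj₁; proj₂)
open import Data.Product.Function.NonDependent.Propositional using (_×-↔_)
open import Data.Rational.Base as ℚ using (ℚ; 0ℚ; toℚᵘ; fromℚᵘ)
import Data.Rational.Properties as ℚ
open import Data.Rational.Unnormalised.Base as ℚᵘ using (ℚᵘ; mkℚᵘ; *≡*)
import Data.Rational.Unnormalised.Properties as ℚᵘ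
open import Data.Sum.Base using (_⊎_; inj₁; inj₂; fromInj₁; fromInj₂)
open import Data.Sum.Function.Propositional using (_⊎-↔_)
open import Data.Unit.Base using (⊤; tt)
open import Function.Base using (_∘_)
open import Function.Bundles using (_↔_; Inverse; mk⇔; mk↔ₛ′; Equivalence)
open import Function.Properties.Inverse using (↔-refl; ↔-sym; ↔-trans)
open import Relation.Binary.Bundles using (Setoid)
open import Relation.Binary.PropositionalEquality
  using (_≡_; _≢_; refl; sym; trans; cong; cong₂; subst; subst₂; module ≡-Reasoning)
open import Relation.Nullary using (¬_; Dec; yes; no; contradiction)
open import Relation.Nullary.Decidable using (⌊_⌋; toWitness; fromWitness; map′)

-- Counting tilings

-- Between tilings and matchings stands a third description: n-periodic sequences of phases with
-- only permitted steps. Tilings are compared with it by cutting the cycle where a tile begins,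
-- matchings by local arguments about adjacent edges. The value n = 4 is exceptional because `u i`,
-- `u (i + 2)`, `u (i + 4)` then traverse one edge twice: the two neighbours of `u i` on the outer
-- cycles coincide, and the four tilings of the 4-cycle by one block give only two matchings. Both
-- the injectivity of the correspondence and the propagation along the `u`-edges need these
-- neighbours to differ.

-- The number of tilings of a path by l single cells and four-cell blocks that
-- cover k cells.
count : ℕ → ℕ → ℕ
count 0 l = 1
count 1 l = 0
count 2 l = 0
count 3 l = 0
count (suc (suc (suc (suc k)))) zero    = count k zero
count (suc (suc (suc (suc k)))) (suc l) = count (4 + k) l + count k (suc l)

-- Laying one more block: multiplication by the fourth power of the variable that marks block cells.
-- The default 0 says that no block fits into fewer than four cells.
shift4 : (ℕ → ℕ → ℕ) → ℕ → ℕ → ℕ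
shift4 f (suc (suc (suc (suc k)))) l = f k l
shift4 f _                         l = 0

-- The sum over k + l = n, where k counts the cells inside blocks and not the blocks. Since `count`
-- vanishes unless 4 divides k, the congruence on n - l is enforced by the summands themselves.
antidiagonal : (ℕ → ℕ → ℕ) → ℕ → ℕ
antidiagonal f zero    = f 0 0
antidiagonal f (suc n) = f (suc n) 0 + antidiagonal (λ k l → f k (suc l)) n

antidiagonal-cong : ∀ {f g} → (∀ k l → f k l ≡ g k l) → ∀ n → antidiagonal f n ≡ antidiagonal g n
antidiagonal-cong eq zero    = eq 0 0
antidiagonal-cong eq (suc n) = cong₂ _+_ (eq (suc n) 0) (antidiagonal-cong (λ k l → eq k (suc l)) n)

antidiagonal-+ : ∀ f g n → antidiagonal (λ k l → f k l + g k l) n ≡ antidiagonal f n + antidiagonal g n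
antidiagonal-+ f g zero    = refl
antidiagonal-+ f g (suc n) = trans
  (cong ((f (suc n) 0 + g (suc n) 0) +_) (antidiagonal-+ (λ k l → f k (suc l)) (λ k l → g k (suc l)) n))
  (interchange (f (suc n) 0) (g (suc n) 0) _ _)

antidiagonal-* : ∀ c f n → antidiagonal (λ k l → c * f k l) n ≡ c * antidiagonal f n
antidiagonal-* c f zero    = refl
antidiagonal-* c f (suc n) = trans
  (cong (c * f (suc n) 0 +_) (antidiagonal-* c (λ k l → f k (suc l)) n))
  (sym (*-distribˡ-+ c (f (suc n) 0) _))

shift4-suc : ∀ f k l → shift4 f k (suc l) ≡ shift4 (λ k l → f k (suc l)) k l
shift4-suc f 0 l = refl
shift4-suc f 1 l = refl
shift4-suc f 2 l = refl
shift4-suc f 3 l = refl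
shift4-suc f (suc (suc (suc (suc k)))) l = refl

antidiagonal-shift4 : ∀ f n → antidiagonal (shift4 f) (4 + n) ≡ antidiagonal f n
antidiagonal-shift4 f zero    = +-identityʳ (f 0 0)
antidiagonal-shift4 f (suc n) = cong (λ s → f (suc n) 0 + s) (trans
  (antidiagonal-cong (shift4-suc f) (4 + n))
  (antidiagonal-shift4 (λ k l → f k (suc l)) n))

#tilings : ℕ → ℕ
#tilings (suc m@(suc (suc (suc n)))) = #tilings m + #tilings n
#tilings _                           = 1

#cyclic : ℕ → ℕ
#cyclic (suc (suc (suc (suc n)))) = #tilings (4 + n) + 3 * #tilings n
#cyclic n                         = #tilings n

-- The recursion on the first tile in a form uniform in k, so that it can be summed along an
-- antidiagonal.
count-suc : ∀ k l → count k (suc l) ≡ count k l + shift4 count k (suc l)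
count-suc 0 l = refl
count-suc 1 l = refl
count-suc 2 l = refl
count-suc 3 l = refl
count-suc (suc (suc (suc (suc k)))) l = refl

antidiagonal-count : ∀ n → antidiagonal count n ≡ #tilings n
antidiagonal-count 0 = refl
antidiagonal-count 1 = refl
antidiagonal-count 2 = refl
antidiagonal-count 3 = refl
antidiagonal-count (suc m@(suc (suc (suc n)))) = begin
  count n 0 + antidiagonal (λ k l → count k (suc l)) m
    ≡⟨ cong (count n 0 +_) (trans (antidiagonal-cong count-suc m)
         (antidiagonal-+ count (λ k l → shift4 count k (suc l)) m)) ⟩
  count n 0 + (antidiagonal count m + antidiagonal (λ k l → shift4 count k (suc l)) m)
    -- The term with l = 0 is exactly the end that the shifted sum lacks to be a full antidiagonal
    -- for 4 + n.
    ≡⟨ x∙yz≈y∙xz (count n 0) (antidiagonal count m) _ ⟩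
  antidiagonal count m + antidiagonal (shift4 count) (4 + n)
    ≡⟨ cong₂ _+_ (antidiagonal-count m)
         (trans (antidiagonal-shift4 count n) (antidiagonal-count n)) ⟩
  #tilings m + #tilings n ∎
  where
  open ≡-Reasoning

-- 3 tilings of the cycle for each path tiling with one block fewer: the block
-- containing both of the cells n - 1 and 0 has 3 possible positions.
cyclicCount : ℕ → ℕ → ℕ
cyclicCount k l = count k l + 3 * shift4 count k l

antidiagonal-cyclicCount : ∀ n → antidiagonal cyclicCount n ≡ #cyclic n
antidiagonal-cyclicCount 0 = refl
antidiagonal-cyclicCount 1 = refl
antidiagonal-cyclicCount 2 = refl
antidiagonal-cyclicCount 3 = refl
antidiagonal-cyclicCount n@(suc (suc (suc (suc m)))) = begin
  antidiagonal cyclicCount n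
    ≡⟨ antidiagonal-+ count (λ k l → 3 * shift4 count k l) n ⟩
  antidiagonal count n + antidiagonal (λ k l → 3 * shift4 count k l) n
    ≡⟨ cong₂ _+_ (antidiagonal-count n) (antidiagonal-* 3 (shift4 count) n) ⟩
  #tilings n + 3 * antidiagonal (shift4 count) n
    ≡⟨ cong (λ s → #tilings n + 3 * s) (trans (antidiagonal-shift4 count m) (antidiagonal-count m)) ⟩
  #cyclic n ∎
  where open ≡-Reasoning

-- Binomial coefficients and the factor n/(l+m)

count-multiple : ∀ m l → count (m * 4) l ≡ (l + m) C l
count-multiple zero    l       = sym (trans (cong (_C l) (+-identityʳ l)) (nCn≡1 l))
count-multiple (suc m) zero    = count-multiple m 0
count-multiple (suc m) (suc l) = begin
  count (suc m * 4) l + count (m * 4) (suc l)  ≡⟨ cong₂ _+_ (count-multiple (suc m) l) (count-multiple m (suc l)) ⟩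
  (l + suc m) C l + (suc l + m) C suc l        ≡⟨ cong (λ x → (l + suc m) C l + x C suc l) (+-suc l m) ⟨
  (l + suc m) C l + (l + suc m) C suc l        ≡⟨ nCk+nC[k+1]≡[n+1]C[k+1] (l + suc m) l ⟩
  (suc l + suc m) C suc l                      ∎
  where open ≡-Reasoning

count-nonmultiple : ∀ k l → ¬ 4 ∣ k → count k l ≡ 0
count-nonmultiple 0 l 4∤k = contradiction (4 ∣0) 4∤k
count-nonmultiple 1 l 4∤k = refl
count-nonmultiple 2 l 4∤k = refl
count-nonmultiple 3 l 4∤k = refl
count-nonmultiple (suc (suc (suc (suc k)))) zero    4∤k =
  count-nonmultiple k 0 λ { (divides m refl) → 4∤k (divides (suc m) refl) }
count-nonmultiple (suc (suc (suc (suc k)))) (suc l) 4∤k =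
  cong₂ _+_ (count-nonmultiple (4 + k) l 4∤k)
            (count-nonmultiple k (suc l) λ { (divides m refl) → 4∤k (divides (suc m) refl) })

cyclicCount-nonmultiple : ∀ k l → ¬ 4 ∣ k → cyclicCount k l ≡ 0
cyclicCount-nonmultiple k l 4∤k = cong₂ (λ a b → a + 3 * b) (count-nonmultiple k l 4∤k) (lemma k 4∤k)
  where
  lemma : ∀ k → ¬ 4 ∣ k → shift4 count k l ≡ 0
  lemma 0 _ = refl
  lemma 1 _ = refl
  lemma 2 _ = refl
  lemma 3 _ = refl
  lemma (suc (suc (suc (suc k)))) 4∤k =
    count-nonmultiple k l λ { (divides m refl) → 4∤k (divides (suc m) refl) }

-- m C(l+m, l) = (l+m) C(l+m-1, l) and its mirror image; under Pascal's rule each of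
-- them reduces to the other.
absorption-block : ∀ m l → suc m * count (suc m * 4) l ≡ (l + suc m) * count (m * 4) l
absorption-single : ∀ m l → suc l * count (m * 4) (suc l) ≡ (l + suc m) * count (m * 4) l

absorption-block m zero    = refl
absorption-block m (suc l) = begin
  suc m * (count (suc m * 4) l + count (m * 4) (suc l))
    ≡⟨ *-distribˡ-+ (suc m) (count (suc m * 4) l) _ ⟩
  suc m * count (suc m * 4) l + suc m * count (m * 4) (suc l)
    ≡⟨ cong (λ s → s + suc m * count (m * 4) (suc l))
         (trans (absorption-block m l) (sym (absorption-single m l))) ⟩
  suc l * count (m * 4) (suc l) + suc m * count (m * 4) (suc l)
    ≡⟨ *-distribʳ-+ (count (m * 4) (suc l)) (suc l) (suc m) ⟨
  (suc l + suc m) * count (m * 4) (suc l) ∎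
  where open ≡-Reasoning

absorption-single zero    l = cong (λ x → x * 1) (+-comm 1 l)
absorption-single (suc m) l = begin
  suc l * (count (suc m * 4) l + count (m * 4) (suc l))
    ≡⟨ *-distribˡ-+ (suc l) (count (suc m * 4) l) _ ⟩
  suc l * count (suc m * 4) l + suc l * count (m * 4) (suc l)
    ≡⟨ cong (λ s → suc l * count (suc m * 4) l + s)
         (trans (absorption-single m l) (sym (absorption-block m l))) ⟩
  suc l * count (suc m * 4) l + suc m * count (suc m * 4) l
    ≡⟨ *-distribʳ-+ (count (suc m * 4) l) (suc l) (suc m) ⟨
  (suc l + suc m) * count (suc m * 4) l
    ≡⟨ cong (_* count (suc m * 4) l) (+-suc l (suc m)) ⟨
  (l + suc (suc m)) * count (suc m * 4) l ∎
  where open ≡-Reasoning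

-- The 4m + l cells consist of l + m cells that begin a tile and 3m that do not. The first kind
-- yields `count` itself, and absorption turns the second into the straddling term.
cyclicCount-multiple : ∀ m l → (m * 4 + l) * ((l + m) C l) ≡ cyclicCount (m * 4) l * (l + m)
cyclicCount-multiple zero    l rewrite +-identityʳ l | nCn≡1 l = lemma l
  where
  lemma : ∀ l → l * 1 ≡ (1 + 3 * 0) * l
  lemma = solve-∀
cyclicCount-multiple (suc m) l = begin
  (suc m * 4 + l) * ((l + suc m) C l)
    ≡⟨ cong ((suc m * 4 + l) *_) (count-multiple (suc m) l) ⟨
  (suc m * 4 + l) * count (suc m * 4) l
    ≡⟨ expand m l (count (suc m * 4) l) ⟩
  count (suc m * 4) l * (l + suc m) + 3 * (suc m * count (suc m * 4) l)
    ≡⟨ cong (λ s → count (suc m * 4) l * (l + suc m) + 3 * s) (absorption-block m l) ⟩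
  count (suc m * 4) l * (l + suc m) + 3 * ((l + suc m) * count (m * 4) l)
    ≡⟨ collect (count (suc m * 4) l) (count (m * 4) l) (l + suc m) ⟩
  cyclicCount (suc m * 4) l * (l + suc m) ∎
  where
  open ≡-Reasoning
  expand : ∀ m l c → (suc m * 4 + l) * c ≡ c * (l + suc m) + 3 * (suc m * c)
  expand = solve-∀
  collect : ∀ c d x → c * x + 3 * (x * d) ≡ (c + 3 * d) * x
  collect = solve-∀

-- The sum of the theorem as a rational number

infix 8 _/1
_/1 : ℕ → ℚ
n /1 = ℤ.+ n ℚ./ 1

-- On unnormalised fractions the claim is mere cross-multiplication; normalised ones would bring in
-- greatest common divisors.
fraction-* : ∀ a b c d .{{_ : NonZero d}} → a * b ≡ c * d → (ℤ.+ a ℚ./ d) ℚ.* b /1 ≡ c /1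
fraction-* a b c d@(suc e) eq = ℚ.toℚᵘ-injective (begin
  toℚᵘ (fromℚᵘ a/d ℚ.* fromℚᵘ b/1)             ≈⟨ ℚ.toℚᵘ-homo-* (fromℚᵘ a/d) (fromℚᵘ b/1) ⟩
  toℚᵘ (fromℚᵘ a/d) ℚᵘ.* toℚᵘ (fromℚᵘ b/1)     ≈⟨ ℚᵘ.*-cong (ℚ.toℚᵘ-fromℚᵘ a/d) (ℚ.toℚᵘ-fromℚᵘ b/1) ⟩
  a/d ℚᵘ.* b/1                                 ≈⟨ *≡* lemma ⟩
  mkℚᵘ (ℤ.+ c) 0                               ≈⟨ ℚ.toℚᵘ-fromℚᵘ (mkℚᵘ (ℤ.+ c) 0) ⟨
  toℚᵘ (fromℚᵘ (mkℚᵘ (ℤ.+ c) 0))               ∎)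
  where
  open ℚᵘ.≃-Reasoning
  a/d b/1 : ℚᵘ
  a/d = mkℚᵘ (ℤ.+ a) e
  b/1 = mkℚᵘ (ℤ.+ b) 0
  lemma : (ℤ.+ a ℤ.* ℤ.+ b) ℤ.* ℤ.+ 1 ≡ ℤ.+ c ℤ.* (ℤ.+ d ℤ.* ℤ.+ 1)
  lemma = trans (ℤ.*-identityʳ (ℤ.+ a ℤ.* ℤ.+ b)) (trans (sym (ℤ.pos-* a b)) (trans (cong ℤ.+_ eq)
    (trans (ℤ.pos-* c d) (cong (ℤ.+ c ℤ.*_) (sym (ℤ.*-identityʳ (ℤ.+ d)))))))

/1-homo-+ : ∀ a b → a /1 ℚ.+ b /1 ≡ (a + b) /1
/1-homo-+ a b = ℚ.toℚᵘ-injective (begin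
  toℚᵘ (a /1 ℚ.+ b /1)                         ≈⟨ ℚ.toℚᵘ-homo-+ (a /1) (b /1) ⟩
  toℚᵘ (a /1) ℚᵘ.+ toℚᵘ (b /1)                 ≈⟨ ℚᵘ.+-cong (ℚ.toℚᵘ-fromℚᵘ (mkℚᵘ (ℤ.+ a) 0)) (ℚ.toℚᵘ-fromℚᵘ (mkℚᵘ (ℤ.+ b) 0)) ⟩
  mkℚᵘ (ℤ.+ a) 0 ℚᵘ.+ mkℚᵘ (ℤ.+ b) 0           ≈⟨ *≡* lemma ⟩
  mkℚᵘ (ℤ.+ (a + b)) 0                         ≈⟨ ℚ.toℚᵘ-fromℚᵘ (mkℚᵘ (ℤ.+ (a + b)) 0) ⟨
  toℚᵘ ((a + b) /1)                            ∎)
  where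
  open ℚᵘ.≃-Reasoning
  lemma : (ℤ.+ a ℤ.* ℤ.+ 1 ℤ.+ ℤ.+ b ℤ.* ℤ.+ 1) ℤ.* ℤ.+ 1 ≡ ℤ.+ (a + b) ℤ.* ℤ.+ 1
  lemma = cong (ℤ._* ℤ.+ 1) (cong₂ ℤ._+_ (ℤ.*-identityʳ (ℤ.+ a)) (ℤ.*-identityʳ (ℤ.+ b)))

sum-antidiagonal : ∀ (s : ℕ → ℚ) f n → (∀ k l → k + l ≡ n → s l ≡ f k l /1) →
                   foldr ℚ._+_ 0ℚ (applyUpTo s (suc n)) ≡ antidiagonal f n /1
sum-antidiagonal s f zero    eq = trans (ℚ.+-identityʳ (s 0)) (eq 0 0 refl)
sum-antidiagonal s f (suc n) eq = trans
  (cong₂ ℚ._+_ (eq (suc n) 0 (+-identityʳ (suc n)))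
    (sum-antidiagonal (λ l → s (suc l)) (λ k l → f k (suc l)) n
      λ k l p → eq k (suc l) (trans (+-suc k l) (cong suc p))))
  (/1-homo-+ (f (suc n) 0) _)

module _ (n : ℕ) (n≥3 : n ≥ 3) where
  open GeneralizedPetersen n n≥3 using (summand)

  summand≡cyclicCount : ∀ k l → k + l ≡ n → summand l ≡ cyclicCount k l /1
  summand≡cyclicCount k l refl with 4 ∣? (k + l ∸ l)
  ... | no 4∤ = sym (cong _/1 (cyclicCount-nonmultiple k l (subst (λ x → ¬ 4 ∣ x) (m+n∸n≡m k l) 4∤)))
  ... | yes 4∣ = lemma k (k + l ∸ l) (m+n∸n≡m k l) 4∣ (denominator-nonZero k l (k + l ∸ l) (m+n∸n≡m k l) 4∣ n≥3)
    where
    denominator-nonZero : ∀ k l x → x ≡ k → 4 ∣ x → k + l ≥ 3 → NonZero (l + x div 4)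
    denominator-nonZero k (suc l) x    p    4∣x                  n≥3 = _
    denominator-nonZero _ zero    _    refl (divides (suc m) refl) n≥3 = subst NonZero (sym (m*n/n≡m (suc m) 4)) _
    denominator-nonZero _ zero    _    refl (divides zero refl)    ()
    -- With the difference abstracted to x, matching on the two proofs makes k equal to m * 4. As
    -- `nz` is irrelevant, it may be any proof, in particular the one inside `summand`.
    lemma : ∀ k x → x ≡ k → 4 ∣ x → .(nz : NonZero (l + x div 4)) →
            (ℤ.+ (k + l) ℚ./ (l + x div 4)) {{nz}} ℚ.* ((l + x div 4) C l) /1 ≡ cyclicCount k l /1
    lemma k _ refl (divides m refl) nz = fraction-* (k + l) ((l + m * 4 div 4) C l) (cyclicCount (m * 4) l) _ {{nz}}
      (subst (λ q → (m * 4 + l) * ((l + q) C l) ≡ cyclicCount (m * 4) l * (l + q))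
        (sym (m*n/n≡m m 4)) (cyclicCount-multiple m l))

  formula≡#cyclic : n ≢ 4 → formula n n≥3 ≡ #cyclic n /1
  formula≡#cyclic n≢4 with n ≟ 4
  ... | yes n≡4 = contradiction n≡4 n≢4
  ... | no  _   = begin
    foldr ℚ._+_ 0ℚ (map summand (upTo (suc n)))   ≡⟨ cong (foldr ℚ._+_ 0ℚ) (map-upTo summand (suc n)) ⟩
    foldr ℚ._+_ 0ℚ (applyUpTo summand (suc n))    ≡⟨ sum-antidiagonal summand cyclicCount n summand≡cyclicCount ⟩
    antidiagonal cyclicCount n /1                 ≡⟨ cong _/1 (antidiagonal-cyclicCount n) ⟩
    #cyclic n /1                                  ∎
    where open ≡-Reasoning

-- Tilings of the cycle as closed walks

-- The role of an index i in a tiling of the cycle by spokes and blocks of four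
-- consecutive indices: bⱼ when i is the j-th index of a block.
data Phase : Set where
  spoke b₁ b₂ b₃ b₄ : Phase

data Step : Phase → Phase → Set where
  spoke-spoke : Step spoke spoke
  spoke-b₁    : Step spoke b₁
  b₁-b₂       : Step b₁ b₂
  b₂-b₃       : Step b₂ b₃
  b₃-b₄       : Step b₃ b₄
  b₄-spoke    : Step b₄ spoke
  b₄-b₁       : Step b₄ b₁

-- Sequences run over all of ℕ and closing up is the separate condition `Periodic`, so that
-- inductions along the cycle never have to wrap around.
Walk : (ℕ → Phase) → Set
Walk p = ∀ k → Step (p k) (p (suc k))

Periodic : ℕ → (ℕ → Phase) → Set
Periodic n p = ∀ k → p (k + n) ≡ p k

data Start : Phase → Set where
  start-spoke : Start spoke
  start-b₁    : Start b₁

spoke? : (x : Phase) → Dec (x ≡ spoke)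
spoke? spoke = yes refl
spoke? b₁    = no λ ()
spoke? b₂    = no λ ()
spoke? b₃    = no λ ()
spoke? b₄    = no λ ()

-- A phase that a spoke may follow completes a tile, so any tile may begin after it.
step-start : ∀ {x y} → Step x spoke → Start y → Step x y
step-start spoke-spoke start-spoke = spoke-spoke
step-start spoke-spoke start-b₁    = spoke-b₁
step-start b₄-spoke    start-spoke = b₄-spoke
step-start b₄-spoke    start-b₁    = b₄-b₁

start-after-spoke : ∀ {x} → Step spoke x → Start x
start-after-spoke spoke-spoke = start-spoke
start-after-spoke spoke-b₁    = start-b₁

start-after-b₄ : ∀ {x} → Step b₄ x → Start x
start-after-b₄ b₄-spoke = start-spoke
start-after-b₄ b₄-b₁    = start-b₁

after-b₁ : ∀ {x y} → Step x y → x ≡ b₁ → y ≡ b₂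
after-b₁ b₁-b₂ refl = refl

after-b₂ : ∀ {x y} → Step x y → x ≡ b₂ → y ≡ b₃
after-b₂ b₂-b₃ refl = refl

after-b₃ : ∀ {x y} → Step x y → x ≡ b₃ → y ≡ b₄
after-b₃ b₃-b₄ refl = refl

before-b₂ : ∀ {x y} → Step x y → y ≡ b₂ → x ≡ b₁
before-b₂ b₁-b₂ refl = refl

before-b₃ : ∀ {x y} → Step x y → y ≡ b₃ → x ≡ b₂
before-b₃ b₂-b₃ refl = refl

before-b₄ : ∀ {x y} → Step x y → y ≡ b₄ → x ≡ b₃
before-b₄ b₃-b₄ refl = refl

-- The unique successor other than `spoke`. Hence a walk is determined by its initial phase and the
-- positions of its spokes.
next : Phase → Phase
next spoke = b₁
next b₁    = b₂
next b₂    = b₃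
next b₃    = b₄
next b₄    = b₁

step-next : ∀ x → Step x (next x)
step-next spoke = spoke-b₁
step-next b₁    = b₁-b₂
step-next b₂    = b₂-b₃
step-next b₃    = b₃-b₄
step-next b₄    = b₄-b₁

next≢spoke : ∀ x → next x ≢ spoke
next≢spoke spoke ()
next≢spoke b₁    ()
next≢spoke b₂    ()
next≢spoke b₃    ()
next≢spoke b₄    ()

step-nonspoke : ∀ {x y} → Step x y → y ≢ spoke → y ≡ next x
step-nonspoke spoke-spoke ≢s = contradiction refl ≢s
step-nonspoke spoke-b₁    _  = refl
step-nonspoke b₁-b₂       _  = refl
step-nonspoke b₂-b₃       _  = refl
step-nonspoke b₃-b₄       _  = refl
step-nonspoke b₄-spoke    ≢s = contradiction refl ≢s
step-nonspoke b₄-b₁       _  = refl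

blockPhase : ℕ → Phase
blockPhase 0 = b₁
blockPhase 1 = b₂
blockPhase 2 = b₃
blockPhase 3 = b₄
blockPhase (suc (suc (suc (suc k)))) = blockPhase k

blockPhase-suc : ∀ k → blockPhase (suc k) ≡ next (blockPhase k)
blockPhase-suc 0 = refl
blockPhase-suc 1 = refl
blockPhase-suc 2 = refl
blockPhase-suc 3 = refl
blockPhase-suc (suc (suc (suc (suc k)))) = blockPhase-suc k

blockPhase-walk : Walk blockPhase
blockPhase-walk k = subst (Step (blockPhase k)) (sym (blockPhase-suc k)) (step-next (blockPhase k))

blockPhase-+4 : ∀ k m → blockPhase (k + m * 4) ≡ blockPhase k
blockPhase-+4 k zero    = cong blockPhase (+-identityʳ k)
blockPhase-+4 k (suc m) = trans (cong blockPhase (lemma k m)) (blockPhase-+4 k m)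
  where
  lemma : ∀ k m → k + suc m * 4 ≡ 4 + (k + m * 4)
  lemma = solve-∀

blockPhase-b₁ : ∀ k → blockPhase k ≡ b₁ → 4 ∣ k
blockPhase-b₁ 0 _ = 4 ∣0
blockPhase-b₁ (suc (suc (suc (suc k)))) eq with blockPhase-b₁ k eq
... | divides m refl = divides (suc m) refl

afterSpoke : ℕ → Phase
afterSpoke zero    = spoke
afterSpoke (suc k) = blockPhase k

afterSpoke-suc : ∀ k → afterSpoke (suc k) ≡ next (afterSpoke k)
afterSpoke-suc zero    = refl
afterSpoke-suc (suc k) = blockPhase-suc k

-- Only `spoke` and `b₄` may precede a spoke, and `afterSpoke` takes these values exactly at the
-- multiples of 4. With its converse below, this is what turns the spacing of spokes into a
-- statement about walks.
step-afterSpoke-spoke : ∀ k → Step (afterSpoke k) spoke → 4 ∣ k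
step-afterSpoke-spoke zero    _ = 4 ∣0
step-afterSpoke-spoke (suc k) s = lemma k s
  where
  lemma : ∀ k → Step (blockPhase k) spoke → 4 ∣ suc k
  lemma 3 _ = divides 1 refl
  lemma (suc (suc (suc (suc k)))) s with lemma k s
  ... | divides m eq = divides (suc m) (cong (4 +_) eq)

afterSpoke-step-spoke : ∀ k → 4 ∣ k → Step (afterSpoke k) spoke
afterSpoke-step-spoke _ (divides zero    refl) = spoke-spoke
afterSpoke-step-spoke _ (divides (suc m) refl) =
  subst (λ x → Step x spoke) (sym (blockPhase-+4 3 m)) b₄-spoke

walk-afterSpoke : ∀ {p} → Walk p → ∀ i → p i ≡ spoke → ∀ g →
                  (∀ k → i < k → k ≤ g + i → p k ≢ spoke) → p (g + i) ≡ afterSpoke g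
walk-afterSpoke walk i pi zero    none = pi
walk-afterSpoke walk i pi (suc g) none = trans
  (step-nonspoke (walk (g + i)) (none (suc (g + i)) (s≤s (m≤n+m i g)) ≤-refl))
  (trans (cong next (walk-afterSpoke walk i pi g λ k i<k k≤ → none k i<k (m≤n⇒m≤1+n k≤)))
         (sym (afterSpoke-suc g)))

spokeGap : ∀ {p} → Walk p → ∀ i g → p i ≡ spoke → p (suc g + i) ≡ spoke →
           (∀ k → i < k → k < suc g + i → p k ≢ spoke) → 4 ∣ g
spokeGap {p} walk i g pi pj none = step-afterSpoke-spoke g
  (subst₂ Step (walk-afterSpoke walk i pi g λ k i<k k≤ → none k i<k (s≤s k≤)) pj (walk (g + i)))

module _ {p : ℕ → Phase} (walk : Walk p) (none : ∀ k → p k ≢ spoke) where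

  private
    p-suc : ∀ k → p (suc k) ≡ next (p k)
    p-suc k = step-nonspoke (walk k) (none (suc k))

  spokeless-start : ∃[ i ] p i ≡ b₁
  spokeless-start = go (p 0) refl
    where
    go : ∀ x → p 0 ≡ x → ∃[ i ] p i ≡ b₁
    go spoke eq = contradiction eq (none 0)
    go b₁    eq = 0 , eq
    go b₂    eq = 3 , trans (p-suc 2) (cong next (trans (p-suc 1) (cong next (trans (p-suc 0) (cong next eq)))))
    go b₃    eq = 2 , trans (p-suc 1) (cong next (trans (p-suc 0) (cong next eq)))
    go b₄    eq = 1 , trans (p-suc 0) (cong next eq)

  spokeless-blockPhase : ∀ i → p i ≡ b₁ → ∀ k → p (k + i) ≡ blockPhase k
  spokeless-blockPhase i eq zero    = eq
  spokeless-blockPhase i eq (suc k) =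
    trans (p-suc (k + i)) (trans (cong next (spokeless-blockPhase i eq k)) (sym (blockPhase-suc k)))

  spokeless-4∣period : ∀ {n} → Periodic n p → 4 ∣ n
  spokeless-4∣period {n} periodic with i , pi ← spokeless-start =
    blockPhase-b₁ n (trans (sym (spokeless-blockPhase i pi n))
      (trans (cong p (+-comm n i)) (trans (periodic i) pi)))

-- Tilings of the path and of the cycle

data Tiling : ℕ → Set where
  []     : Tiling 0
  single : ∀ {n} → Tiling n → Tiling (suc n)
  block  : ∀ {n} → Tiling n → Tiling (4 + n)

data CyclicTiling : ℕ → Set where
  aligned    : ∀ {n} → Tiling n → CyclicTiling n
  straddling : ∀ {n} → Fin 3 → Tiling n → CyclicTiling (4 + n)

-- The default `spoke` beyond the end keeps the sequence a walk. The step into index n then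
-- certifies that the last tile is complete, which is needed to close the cycle.
phaseAt : ∀ {n} → Tiling n → ℕ → Phase
phaseAt []         _       = spoke
phaseAt (single t) zero    = spoke
phaseAt (single t) (suc k) = phaseAt t k
phaseAt (block t)  0       = b₁
phaseAt (block t)  1       = b₂
phaseAt (block t)  2       = b₃
phaseAt (block t)  3       = b₄
phaseAt (block t)  (suc (suc (suc (suc k)))) = phaseAt t k

phaseAt-start : ∀ {n} (t : Tiling n) → Start (phaseAt t 0)
phaseAt-start []         = start-spoke
phaseAt-start (single t) = start-spoke
phaseAt-start (block t)  = start-b₁

phaseAt-walk : ∀ {n} (t : Tiling n) → Walk (phaseAt t)
phaseAt-walk []         k       = spoke-spoke
phaseAt-walk (single t) zero    = step-start spoke-spoke (phaseAt-start t)
phaseAt-walk (single t) (suc k) = phaseAt-walk t k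
phaseAt-walk (block t)  0       = b₁-b₂
phaseAt-walk (block t)  1       = b₂-b₃
phaseAt-walk (block t)  2       = b₃-b₄
phaseAt-walk (block t)  3       = step-start b₄-spoke (phaseAt-start t)
phaseAt-walk (block t)  (suc (suc (suc (suc k)))) = phaseAt-walk t k

phaseAt-end : ∀ {n} (t : Tiling n) → phaseAt t n ≡ spoke
phaseAt-end []         = refl
phaseAt-end (single t) = phaseAt-end t
phaseAt-end (block t)  = phaseAt-end t

phaseAt-injective : ∀ {n} (t t′ : Tiling n) → (∀ k → k < n → phaseAt t k ≡ phaseAt t′ k) → t ≡ t′
phaseAt-injective []         []          eq = refl
phaseAt-injective (single t) (single t′) eq =
  cong single (phaseAt-injective t t′ λ k k<n → eq (suc k) (s≤s k<n))
phaseAt-injective (block t)  (block t′)  eq =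
  cong block (phaseAt-injective t t′ λ k k<n → eq (4 + k) (+-monoʳ-< 4 k<n))
phaseAt-injective (single t) (block t′)  eq with () ← eq 0 z<s
phaseAt-injective (block t)  (single t′) eq with () ← eq 0 z<s

-- `Start (p n)` prevents the end of the path from cutting a block: with fewer than four cells left,
-- `b₂`, `b₃` or `b₄` would stand at n.
parse : ∀ n {p} → Walk p → Start (p 0) → Start (p n) →
        ∃[ t ] (∀ k → k < n → phaseAt {n} t k ≡ p k)
parse n {p} walk s e with p 0 in p0
parse zero walk s e | _ = [] , λ _ ()
parse (suc n) {p} walk start-spoke e | spoke
  with t , eq ← parse n (walk ∘ suc) (start-after-spoke (subst (λ x → Step x (p 1)) p0 (walk 0))) e =
  single t , λ { zero _ → sym p0 ; (suc k) (s≤s k<n) → eq k k<n }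
parse (suc n) {p} walk start-b₁ e | b₁ = go n e
  where
  p1 : p 1 ≡ b₂
  p1 = after-b₁ (walk 0) p0
  p2 : p 2 ≡ b₃
  p2 = after-b₂ (walk 1) p1
  p3 : p 3 ≡ b₄
  p3 = after-b₃ (walk 2) p2
  go : ∀ n → Start (p (suc n)) → ∃[ t ] (∀ k → k < suc n → phaseAt {suc n} t k ≡ p k)
  go 0 e with () ← subst Start p1 e
  go 1 e with () ← subst Start p2 e
  go 2 e with () ← subst Start p3 e
  go (suc (suc (suc n))) e
    with t , eq ← parse n (λ k → walk (4 + k)) (start-after-b₄ (subst (λ x → Step x (p 4)) p3 (walk 3))) e =
    block t , λ where
      0 _ → sym p0
      1 _ → sym p1
      2 _ → sym p2
      3 _ → sym p3
      (suc (suc (suc (suc k)))) (s≤s (s≤s (s≤s (s≤s k<n)))) → eq k k<n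

suc-% : ∀ k n .{{_ : NonZero n}} →
        (suc (k % n) < n × suc k % n ≡ suc (k % n)) ⊎ (suc (k % n) ≡ n × suc k % n ≡ 0)
suc-% k n = by-cases (m≤n⇒m<n∨m≡n (m%n<n k n))
  where
  reduce : suc k % n ≡ suc (k % n) % n
  reduce = trans (cong (λ x → suc x % n) (m≡m%n+[m/n]*n k n)) ([m+kn]%n≡m%n (suc (k % n)) (k div n) n)
  by-cases : suc (k % n) < n ⊎ suc (k % n) ≡ n → _
  by-cases (inj₁ lt) = inj₁ (lt , trans reduce (m<n⇒m%n≡m lt))
  by-cases (inj₂ eq) = inj₂ (eq , trans reduce (trans (cong (_% n) eq) (n%n≡0 n)))

periodic-* : ∀ {n p} → Periodic n p → ∀ m k → p (k + m * n) ≡ p k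
periodic-* {n} {p} periodic zero    k = cong p (+-identityʳ k)
periodic-* {n} {p} periodic (suc m) k = trans
  (cong p (x∙yz≈xz∙y k n (m * n))) (trans (periodic (k + m * n)) (periodic-* periodic m k))

periodic-% : ∀ {n p} .{{_ : NonZero n}} → Periodic n p → ∀ k → p (k % n) ≡ p k
periodic-% {n} {p} periodic k = trans
  (sym (periodic-* periodic (k div n) (k % n))) (cong p (sym (m≡m%n+[m/n]*n k n)))

tiling : ∀ {n} → CyclicTiling n → Tiling n
tiling (aligned t)      = t
tiling (straddling r t) = block t

-- A straddling tiling is cut at the start of its straddling block, and index 0 then lies 1, 2 or 3
-- cells into that block. Offset 0 is left to the aligned tilings, so no tiling occurs twice.
offset : ∀ {n} → CyclicTiling n → ℕ
offset (aligned t)      = 0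
offset (straddling r t) = suc (toℕ r)

module _ {n : ℕ} .{{_ : NonZero n}} where

  cyclicPhaseAt : CyclicTiling n → ℕ → Phase
  cyclicPhaseAt c k = phaseAt (tiling c) ((k + offset c) % n)

  cyclicPhaseAt-walk : ∀ c → Walk (cyclicPhaseAt c)
  cyclicPhaseAt-walk c k with suc-% (k + offset c) n
  ... | inj₁ (_ , eq)  rewrite eq = phaseAt-walk (tiling c) _
  -- At the wrap-around the path steps into its default `spoke`, so its last tile is complete and
  -- the first one may follow.
  ... | inj₂ (last , eq) rewrite eq = step-start
    (subst (Step _) (trans (cong (phaseAt (tiling c)) last) (phaseAt-end (tiling c))) (phaseAt-walk (tiling c) _))
    (phaseAt-start (tiling c))

  cyclicPhaseAt-periodic : ∀ c → Periodic n (cyclicPhaseAt c)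
  cyclicPhaseAt-periodic c k = cong (phaseAt (tiling c))
    (trans (cong (_% n) (xy∙z≈xz∙y k n (offset c))) ([m+n]%n≡m%n (k + offset c) n))

private
  rotation-injective : ∀ {n} .{{_ : NonZero n}} r (t t′ : Tiling n) → r ≤ n →
    (∀ k → phaseAt t ((k + r) % n) ≡ phaseAt t′ ((k + r) % n)) → t ≡ t′
  rotation-injective {n} r t t′ r≤n eq = phaseAt-injective t t′ λ k k<n →
    subst (λ i → phaseAt t i ≡ phaseAt t′ i) (reduce k k<n) (eq (k + (n ∸ r)))
    where
    reduce : ∀ k → k < n → (k + (n ∸ r) + r) % n ≡ k
    reduce k k<n = trans
      (cong (_% n) (trans (+-assoc k (n ∸ r) r) (cong (k +_) (m∸n+n≡m r≤n))))
      (trans ([m+n]%n≡m%n k n) (m<n⇒m%n≡m k<n))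

  start≢straddling : ∀ {n} .{{_ : NonZero (4 + n)}} (t : Tiling (4 + n)) r (t′ : Tiling n) →
    cyclicPhaseAt (aligned t) 0 ≢ cyclicPhaseAt (straddling r t′) 0
  start≢straddling t r t′ eq with s ← phaseAt-start t rewrite eq = lemma r s
    where
    lemma : ∀ r → ¬ Start (cyclicPhaseAt (straddling r t′) 0)
    lemma 0F ()
    lemma 1F ()
    lemma 2F ()

cyclicPhaseAt-injective : ∀ {n} .{{_ : NonZero n}} (c c′ : CyclicTiling n) →
  (∀ k → cyclicPhaseAt c k ≡ cyclicPhaseAt c′ k) → c ≡ c′
cyclicPhaseAt-injective (aligned t) (aligned t′) eq = cong aligned (rotation-injective 0 t t′ z≤n eq)
cyclicPhaseAt-injective (aligned t) (straddling r t′) eq = contradiction (eq 0) (start≢straddling t r t′)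
cyclicPhaseAt-injective (straddling r t) (aligned t′) eq = contradiction (sym (eq 0)) (start≢straddling t′ r t)
cyclicPhaseAt-injective (straddling 0F t) (straddling 0F t′) eq
  with refl ← rotation-injective 1 (block t) (block t′) (s≤s z≤n) eq = refl
cyclicPhaseAt-injective (straddling 1F t) (straddling 1F t′) eq
  with refl ← rotation-injective 2 (block t) (block t′) (s≤s (s≤s z≤n)) eq = refl
cyclicPhaseAt-injective (straddling 2F t) (straddling 2F t′) eq
  with refl ← rotation-injective 3 (block t) (block t′) (s≤s (s≤s (s≤s z≤n))) eq = refl
cyclicPhaseAt-injective (straddling 0F t) (straddling 1F t′) eq with () ← eq 0
cyclicPhaseAt-injective (straddling 0F t) (straddling 2F t′) eq with () ← eq 0
cyclicPhaseAt-injective (straddling 1F t) (straddling 0F t′) eq with () ← eq 0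
cyclicPhaseAt-injective (straddling 1F t) (straddling 2F t′) eq with () ← eq 0
cyclicPhaseAt-injective (straddling 2F t) (straddling 0F t′) eq with () ← eq 0
cyclicPhaseAt-injective (straddling 2F t) (straddling 1F t′) eq with () ← eq 0

-- If no tile begins at 0, the phase there tells how far back the block around it began: at n - 1, n
-- - 2 or n - 3. The cycle is cut there and parsed as a path.
cyclicPhaseAt-surjective : ∀ {n} .{{_ : NonZero n}} → n ≥ 3 → ∀ {p} → Walk p → Periodic n p →
  ∃[ c ] (∀ k → cyclicPhaseAt {n} c k ≡ p k)
cyclicPhaseAt-surjective (s≤s (s≤s (s≤s (z≤n {m})))) {p} walk periodic = go (p 0) refl
  where
  n = 3 + m

  from-start : Start (p 0) → ∃[ c ] (∀ k → cyclicPhaseAt {n} c k ≡ p k)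
  from-start s with t , eq ← parse n walk s (subst Start (sym (periodic 0)) s) =
    aligned t , λ k → trans (eq ((k + 0) % n) (m%n<n (k + 0) n))
                            (trans (periodic-% periodic (k + 0)) (cong p (+-identityʳ k)))

  from-block : ∀ (r : Fin 3) → suc (toℕ r) ≤ n → p (n ∸ suc (toℕ r)) ≡ b₁ → ∃[ c ] (∀ k → cyclicPhaseAt {n} c k ≡ p k)
  from-block r r≤n b = build (parse n {p′} (λ k → walk (k + (n ∸ s))) (subst Start (sym b) start-b₁)
    (subst Start (sym (trans (cong p (+-comm n (n ∸ s))) (trans (periodic (n ∸ s)) b))) start-b₁))
    where
    s = suc (toℕ r)

    p′ : ℕ → Phase
    p′ k = p (k + (n ∸ s))

    p′-periodic : Periodic n p′
    p′-periodic k = trans (cong p (xy∙z≈xz∙y k n (n ∸ s))) (periodic (k + (n ∸ s)))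

    p′-shift : ∀ k → p′ (k + s) ≡ p k
    p′-shift k = trans (cong p (trans (+-assoc k s (n ∸ s)) (cong (k +_) (m+[n∸m]≡n r≤n)))) (periodic k)

    build : ∃[ t ] (∀ k → k < n → phaseAt {n} t k ≡ p′ k) → ∃[ c ] (∀ k → cyclicPhaseAt {n} c k ≡ p k)
    build (single t , eq) with () ← trans (eq 0 z<s) b
    build (block t  , eq) = straddling r t , λ k →
      trans (eq ((k + s) % n) (m%n<n (k + s) n)) (trans (periodic-% p′-periodic (k + s)) (p′-shift k))

  go : ∀ x → p 0 ≡ x → ∃[ c ] (∀ k → cyclicPhaseAt {n} c k ≡ p k)
  go spoke eq = from-start (subst Start (sym eq) start-spoke)
  go b₁    eq = from-start (subst Start (sym eq) start-b₁)
  go b₂    eq = from-block 0F (s≤s z≤n) (before-b₂ (walk (2 + m)) (trans (periodic 0) eq))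
  go b₃    eq = from-block 1F (s≤s (s≤s z≤n))
    (before-b₂ (walk (1 + m)) (before-b₃ (walk (2 + m)) (trans (periodic 0) eq)))
  go b₄    eq = from-block 2F (s≤s (s≤s (s≤s z≤n)))
    (before-b₂ (walk m) (before-b₃ (walk (1 + m)) (before-b₄ (walk (2 + m)) (trans (periodic 0) eq))))

-- Enumeration of the cyclic tilings

Tiling-suc : ∀ n → Tiling (4 + n) ↔ (Tiling (3 + n) ⊎ Tiling n)
Tiling-suc n = mk↔ₛ′
  (λ { (single t) → inj₁ t ; (block t) → inj₂ t })
  (λ { (inj₁ t) → single t ; (inj₂ t) → block t })
  (λ { (inj₁ t) → refl ; (inj₂ t) → refl })
  (λ { (single t) → refl ; (block t) → refl })

unique↔Fin : ∀ {A : Set} (x : A) → (∀ y → x ≡ y) → A ↔ Fin 1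
unique↔Fin x unique = mk↔ₛ′ (λ _ → 0F) (λ _ → x) (λ { 0F → refl ; (suc ()) }) unique

Tiling↔Fin : ∀ n → Tiling n ↔ Fin (#tilings n)
Tiling↔Fin 0 = unique↔Fin [] λ { [] → refl }
Tiling↔Fin 1 = unique↔Fin (single []) λ { (single []) → refl }
Tiling↔Fin 2 = unique↔Fin (single (single [])) λ { (single (single [])) → refl }
Tiling↔Fin 3 = unique↔Fin (single (single (single []))) λ { (single (single (single []))) → refl }
Tiling↔Fin (suc m@(suc (suc (suc n)))) =
  ↔-trans (Tiling-suc n) (↔-trans (Tiling↔Fin m ⊎-↔ Tiling↔Fin n) (↔-sym +↔⊎))

aligned↔ : ∀ {n} → n < 4 → CyclicTiling n ↔ Tiling n
aligned↔ n<4 = mk↔ₛ′ (to n<4) aligned (λ _ → refl) (inv n<4)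
  where
  to : ∀ {n} → n < 4 → CyclicTiling n → Tiling n
  to n<4 (aligned t) = t
  to (s≤s (s≤s (s≤s (s≤s ())))) (straddling r t)
  inv : ∀ {n} (n<4 : n < 4) (c : CyclicTiling n) → aligned (to n<4 c) ≡ c
  inv n<4 (aligned t) = refl
  inv (s≤s (s≤s (s≤s (s≤s ())))) (straddling r t)

CyclicTiling-split : ∀ n → CyclicTiling (4 + n) ↔ (Tiling (4 + n) ⊎ Fin 3 × Tiling n)
CyclicTiling-split n = mk↔ₛ′
  (λ { (aligned t) → inj₁ t ; (straddling r t) → inj₂ (r , t) })
  (λ { (inj₁ t) → aligned t ; (inj₂ (r , t)) → straddling r t })
  (λ { (inj₁ t) → refl ; (inj₂ (r , t)) → refl })
  (λ { (aligned t) → refl ; (straddling r t) → refl })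

CyclicTiling↔Fin : ∀ n → CyclicTiling n ↔ Fin (#cyclic n)
CyclicTiling↔Fin 0 = ↔-trans (aligned↔ (s≤s z≤n)) (Tiling↔Fin 0)
CyclicTiling↔Fin 1 = ↔-trans (aligned↔ (s≤s (s≤s z≤n))) (Tiling↔Fin 1)
CyclicTiling↔Fin 2 = ↔-trans (aligned↔ (s≤s (s≤s (s≤s z≤n)))) (Tiling↔Fin 2)
CyclicTiling↔Fin 3 = ↔-trans (aligned↔ (s≤s (s≤s (s≤s (s≤s z≤n))))) (Tiling↔Fin 3)
CyclicTiling↔Fin (suc (suc (suc (suc n)))) = ↔-trans (CyclicTiling-split n)
  (↔-trans (Tiling↔Fin (4 + n) ⊎-↔ ↔-trans (↔-refl ×-↔ Tiling↔Fin n) (↔-sym *↔×)) (↔-sym +↔⊎))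

-- The automaton that will read a walk off a matching; its input tells whether the next index
-- carries a spoke.
advance : Bool → Phase → Phase
advance true  _ = spoke
advance false x = next x

advance-spoke : ∀ b {x} → T b → advance b x ≡ spoke
advance-spoke true _ = refl

spoke-advance : ∀ b {x} → advance b x ≡ spoke → T b
spoke-advance true      _  = tt
spoke-advance false {x} eq = contradiction eq (next≢spoke x)

advance-next : ∀ b {x} → ¬ T b → advance b x ≡ next x
advance-next true  ¬b = contradiction tt ¬b
advance-next false _  = refl

step-advance : ∀ b x → (T b → Step x spoke) → Step x (advance b x)
step-advance true  x s = s tt
step-advance false x _ = step-next x

-- The matching of a tiling

T-⇔⇒≡ : ∀ {a b} → (T a → T b) → (T b → T a) → a ≡ b
T-⇔⇒≡ {false} {false} f g = refl
T-⇔⇒≡ {false} {true}  f g = ⊥-elim (g tt)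
T-⇔⇒≡ {true}  {false} f g = ⊥-elim (f tt)
T-⇔⇒≡ {true}  {true}  f g = refl

u′-injective : ∀ {n} {a b : Fin n} → u′ a ≡ u′ b → a ≡ b
u′-injective refl = refl

v′-injective : ∀ {n} {a b : Fin n} → v′ a ≡ v′ b → a ≡ b
v′-injective refl = refl

_≟ᵥ_ : ∀ {n} (x y : Vertex n) → Dec (x ≡ y)
u′ a ≟ᵥ u′ b = map′ (cong u′) u′-injective (a ≟ᶠ b)
v′ a ≟ᵥ v′ b = map′ (cong v′) v′-injective (a ≟ᶠ b)
u′ a ≟ᵥ v′ b = no λ ()
v′ a ≟ᵥ u′ b = no λ ()

-- Subscripts modulo n and adjacency

module PetersenMatchings (n : ℕ) (n≥3 : n ≥ 3) where
  open GeneralizedPetersen n n≥3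
  open SimpleGraph P using (Adj; symmetric)
  open PerfectMatching

  instance
    n≢0 : NonZero n
    n≢0 = >-nonZero (≤-trans (s≤s z≤n) n≥3)

  infix 4 _~_
  _~_ : ℕ → ℕ → Set
  i ~ j = i % n ≡ j % n

  ~⇒≡ᶠ : ∀ {i j} → i ~ j → i mod n ≡ j mod n
  ~⇒≡ᶠ {i} {j} eq = toℕ-injective
    (trans (toℕ-fromℕ< (m%n<n i n)) (trans eq (sym (toℕ-fromℕ< (m%n<n j n)))))

  ≡ᶠ⇒~ : ∀ {i j} → i mod n ≡ j mod n → i ~ j
  ≡ᶠ⇒~ {i} {j} eq =
    trans (sym (toℕ-fromℕ< (m%n<n i n))) (trans (cong toℕ eq) (toℕ-fromℕ< (m%n<n j n)))

  u-cong : ∀ {i j} → i ~ j → u i ≡ u j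
  u-cong = cong u′ ∘ ~⇒≡ᶠ

  v-cong : ∀ {i j} → i ~ j → v i ≡ v j
  v-cong = cong v′ ∘ ~⇒≡ᶠ

  u-injective : ∀ {i j} → u i ≡ u j → i ~ j
  u-injective = ≡ᶠ⇒~ ∘ u′-injective

  v-injective : ∀ {i j} → v i ≡ v j → i ~ j
  v-injective = ≡ᶠ⇒~ ∘ v′-injective

  toℕ-mod : ∀ k → toℕ (k mod n) ≡ k % n
  toℕ-mod k = toℕ-fromℕ< (m%n<n k n)

  mod-toℕ : ∀ (a : Fin n) → toℕ a mod n ≡ a
  mod-toℕ a = toℕ-injective (trans (toℕ-mod (toℕ a)) (m<n⇒m%n≡m (toℕ<n a)))

  vertex-elim : (Q : Vertex n → Set) → (∀ k → Q (u k)) → (∀ k → Q (v k)) → ∀ x → Q x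
  vertex-elim Q qu qv (u′ a) = subst (Q ∘ u′) (mod-toℕ a) (qu (toℕ a))
  vertex-elim Q qu qv (v′ a) = subst (Q ∘ v′) (mod-toℕ a) (qv (toℕ a))

  ~-+ : ∀ c {i j} → i ~ j → c + i ~ c + j
  ~-+ c {i} {j} eq = trans (%-distribˡ-+ c i n)
    (trans (cong (λ x → (c % n + x) % n) eq) (sym (%-distribˡ-+ c j n)))

  ~-+ʳ : ∀ c {i j} → i ~ j → i + c ~ j + c
  ~-+ʳ c {i} {j} eq = subst₂ _~_ (+-comm c i) (+-comm c j) (~-+ c eq)

  -- Makes `c * (n ∸ 1)` a substitute for -c modulo n for every c; `n ∸ c` would serve only for c at
  -- most n.
  complement : ∀ c → c * (n ∸ 1) + c ≡ c * n
  complement c = trans (lemma c (n ∸ 1)) (cong (c *_) (suc-pred n))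
    where
    lemma : ∀ c p → c * p + c ≡ c * suc p
    lemma = solve-∀

  +-complement : ∀ k c → k + c * (n ∸ 1) + c ~ k
  +-complement k c = trans
    (cong (_% n) (trans (+-assoc k (c * (n ∸ 1)) c) (cong (k +_) (complement c)))) ([m+kn]%n≡m%n k c n)

  ~-cancel : ∀ c {i j} → c + i ~ c + j → i ~ j
  ~-cancel c {i} {j} eq = trans (sym (reduce i)) (trans (~-+ (c * (n ∸ 1)) eq) (reduce j))
    where
    reduce : ∀ i → c * (n ∸ 1) + (c + i) ~ i
    reduce i = trans (cong (_% n) (x∙yz≈zx∙y (c * (n ∸ 1)) c i)) (+-complement i c)

  ~⇒∣ : ∀ c i → i ~ c + i → n ∣ c
  ~⇒∣ c i eq = m%n≡0⇒n∣m c n (trans (sym (~-cancel i (subst₂ _~_ (sym (+-identityʳ i)) (+-comm c i) eq))) 0%n)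
    where
    0%n : 0 % n ≡ 0
    0%n = m<n⇒m%n≡m (≤-trans (s≤s z≤n) n≥3)

  k≁2+k : ∀ k → ¬ (k ~ 2 + k)
  k≁2+k k eq = contradiction (≤-trans n≥3 (∣⇒≤ (~⇒∣ 2 k eq))) λ { (s≤s (s≤s ())) }

  -- Of the divisors 1, 2, 4 of 4, the bound n ≥ 3 leaves only 4. This keeps `u (k - 2)` and
  -- `u (k + 2)` apart.
  k≁4+k : n ≢ 4 → ∀ k → ¬ (k ~ 4 + k)
  k≁4+k n≢4 k eq = lemma n n≥3 n≢4 (~⇒∣ 4 k eq)
    where
    lemma : ∀ n → n ≥ 3 → n ≢ 4 → ¬ n ∣ 4
    lemma 3 _ _ (divides (suc (suc zero)) ())
    lemma 4 _ n≢4 _ = n≢4 refl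
    lemma (suc (suc (suc (suc (suc n))))) _ _ d = contradiction (∣⇒≤ d) λ { (s≤s (s≤s (s≤s (s≤s ())))) }
    lemma 1 (s≤s ()) _ _
    lemma 2 (s≤s (s≤s ())) _ _

  back : ∀ c k → c ≤ n → c + (k + (n ∸ c)) ~ k
  back c k c≤n = trans (cong (_% n) eq) ([m+n]%n≡m%n k n)
    where
    eq : c + (k + (n ∸ c)) ≡ k + n
    eq = trans (x∙yz≈y∙xz c k (n ∸ c)) (cong (k +_) (m+[n∸m]≡n c≤n))

  2≤n : 2 ≤ n
  2≤n = ≤-trans (s≤s (s≤s z≤n)) n≥3

  1≤n : 1 ≤ n
  1≤n = ≤-trans (s≤s z≤n) n≥3

  uu⁺ : ∀ k → Adj (u k) (u (2 + k))
  uu⁺ k = subst (λ i → Adj (u k) (u i)) (+-comm k 2) (inj₁ (uu k))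

  vv⁺ : ∀ k → Adj (v k) (v (1 + k))
  vv⁺ k = subst (λ i → Adj (v k) (v i)) (+-comm k 1) (inj₁ (vv k))

  adj-u : ∀ {x y} k → x ≡ u k → Adj x y →
          y ≡ v k ⊎ y ≡ u (2 + k) ⊎ ∃[ j ] (y ≡ u j × 2 + j ~ k)
  adj-u k eq (inj₁ (uu i)) = inj₂ (inj₁ (u-cong (trans (cong (_% n) (+-comm i 2)) (~-+ 2 (u-injective eq)))))
  adj-u k eq (inj₁ (uv i)) = inj₁ (v-cong (u-injective eq))
  adj-u k () (inj₁ (vv i))
  adj-u k eq (inj₂ (uu i)) = inj₂ (inj₂ (i , refl , trans (cong (_% n) (+-comm 2 i)) (u-injective eq)))
  adj-u k () (inj₂ (uv i))
  adj-u k () (inj₂ (vv i))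

  adj-v : ∀ {x y} k → x ≡ v k → Adj x y →
          y ≡ u k ⊎ y ≡ v (1 + k) ⊎ ∃[ j ] (y ≡ v j × 1 + j ~ k)
  adj-v k eq (inj₁ (vv i)) = inj₂ (inj₁ (v-cong (trans (cong (_% n) (+-comm i 1)) (~-+ 1 (v-injective eq)))))
  adj-v k () (inj₁ (uv i))
  adj-v k () (inj₁ (uu i))
  adj-v k eq (inj₂ (vv i)) = inj₂ (inj₂ (i , refl , trans (cong (_% n) (+-comm 1 i)) (v-injective eq)))
  adj-v k eq (inj₂ (uv i)) = inj₁ (u-cong (v-injective eq))
  adj-v k () (inj₂ (uu i))

  -- The subscript k - c is written k + (n ∸ c).
  uMate vMate : Phase → ℕ → Vertex n
  uMate spoke k = v k
  uMate b₁    k = u (2 + k)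
  uMate b₂    k = u (2 + k)
  uMate b₃    k = u (k + (n ∸ 2))
  uMate b₄    k = u (k + (n ∸ 2))
  vMate spoke k = u k
  vMate b₁    k = v (1 + k)
  vMate b₂    k = v (k + (n ∸ 1))
  vMate b₃    k = v (1 + k)
  vMate b₄    k = v (k + (n ∸ 1))

  uMate-cong : ∀ x {i j} → i ~ j → uMate x i ≡ uMate x j
  uMate-cong spoke = v-cong
  uMate-cong b₁    = u-cong ∘ ~-+ 2
  uMate-cong b₂    = u-cong ∘ ~-+ 2
  uMate-cong b₃    = u-cong ∘ ~-+ʳ (n ∸ 2)
  uMate-cong b₄    = u-cong ∘ ~-+ʳ (n ∸ 2)

  vMate-cong : ∀ x {i j} → i ~ j → vMate x i ≡ vMate x j
  vMate-cong spoke = u-cong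
  vMate-cong b₁    = v-cong ∘ ~-+ 1
  vMate-cong b₂    = v-cong ∘ ~-+ʳ (n ∸ 1)
  vMate-cong b₃    = v-cong ∘ ~-+ 1
  vMate-cong b₄    = v-cong ∘ ~-+ʳ (n ∸ 1)

  -- The perfect matching of a closed walk

  module CyclicWalk {p : ℕ → Phase} (walk : Walk p) (periodic : Periodic n p) where

    p-cong : ∀ {i j} → i ~ j → p i ≡ p j
    p-cong {i} {j} eq = trans (sym (periodic-% {n} periodic i)) (trans (cong p eq) (periodic-% {n} periodic j))

    p-back₁ : ∀ k → p (1 + (k + (n ∸ 1))) ≡ p k
    p-back₁ k = p-cong (back 1 k 1≤n)

    p-back₂ : ∀ k → p (2 + (k + (n ∸ 2))) ≡ p k
    p-back₂ k = p-cong (back 2 k 2≤n)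

    b₃-back₂ : ∀ k → p k ≡ b₃ → p (k + (n ∸ 2)) ≡ b₁
    b₃-back₂ k eq = before-b₂ (walk _) (before-b₃ (walk _) (trans (p-back₂ k) eq))

    b₄-back₂ : ∀ k → p k ≡ b₄ → p (k + (n ∸ 2)) ≡ b₂
    b₄-back₂ k eq = before-b₃ (walk _) (before-b₄ (walk _) (trans (p-back₂ k) eq))

    b₂-back₁ : ∀ k → p k ≡ b₂ → p (k + (n ∸ 1)) ≡ b₁
    b₂-back₁ k eq = before-b₂ (walk _) (trans (p-back₁ k) eq)

    b₄-back₁ : ∀ k → p k ≡ b₄ → p (k + (n ∸ 1)) ≡ b₃
    b₄-back₁ k eq = before-b₄ (walk _) (trans (p-back₁ k) eq)

    -- The matching is the graph of this map: being an involution makes the relation symmetric, and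
    -- being a function gives each vertex exactly one partner.
    mate : Vertex n → Vertex n
    mate (u′ a) = uMate (p (toℕ a)) (toℕ a)
    mate (v′ a) = vMate (p (toℕ a)) (toℕ a)

    mate-u : ∀ k → mate (u k) ≡ uMate (p k) k
    mate-u k = trans (cong (λ i → uMate (p i) i) (toℕ-mod k))
      (trans (cong (λ x → uMate x (k % n)) (periodic-% {n} periodic k)) (uMate-cong (p k) (m%n%n≡m%n k n)))

    mate-v : ∀ k → mate (v k) ≡ vMate (p k) k
    mate-v k = trans (cong (λ i → vMate (p i) i) (toℕ-mod k))
      (trans (cong (λ x → vMate x (k % n)) (periodic-% {n} periodic k)) (vMate-cong (p k) (m%n%n≡m%n k n)))

    mate-u-at : ∀ k {x} → p k ≡ x → mate (u k) ≡ uMate x k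
    mate-u-at k eq = trans (mate-u k) (cong (λ x → uMate x k) eq)

    mate-v-at : ∀ k {x} → p k ≡ x → mate (v k) ≡ vMate x k
    mate-v-at k eq = trans (mate-v k) (cong (λ x → vMate x k) eq)

    mate-involutive : ∀ x → mate (mate x) ≡ x
    mate-involutive = vertex-elim (λ x → mate (mate x) ≡ x)
      (λ k → trans (cong mate (mate-u k)) (go-u k (p k) refl))
      (λ k → trans (cong mate (mate-v k)) (go-v k (p k) refl))
      where
      forth : ∀ c k → c ≤ n → c + k + (n ∸ c) ~ k
      forth c k c≤n = trans (cong (_% n) (+-assoc c k (n ∸ c))) (back c k c≤n)
      go-u : ∀ k x → p k ≡ x → mate (uMate x k) ≡ u k
      go-u k spoke eq = mate-v-at k eq
      go-u k b₁    eq = trans (mate-u-at (2 + k) (after-b₂ (walk _) (after-b₁ (walk k) eq))) (u-cong (forth 2 k 2≤n))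
      go-u k b₂    eq = trans (mate-u-at (2 + k) (after-b₃ (walk _) (after-b₂ (walk k) eq))) (u-cong (forth 2 k 2≤n))
      go-u k b₃    eq = trans (mate-u-at (k + (n ∸ 2)) (b₃-back₂ k eq)) (u-cong (back 2 k 2≤n))
      go-u k b₄    eq = trans (mate-u-at (k + (n ∸ 2)) (b₄-back₂ k eq)) (u-cong (back 2 k 2≤n))
      go-v : ∀ k x → p k ≡ x → mate (vMate x k) ≡ v k
      go-v k spoke eq = mate-u-at k eq
      go-v k b₁    eq = trans (mate-v-at (1 + k) (after-b₁ (walk k) eq)) (v-cong (forth 1 k 1≤n))
      go-v k b₂    eq = trans (mate-v-at (k + (n ∸ 1)) (b₂-back₁ k eq)) (v-cong (back 1 k 1≤n))
      go-v k b₃    eq = trans (mate-v-at (1 + k) (after-b₃ (walk k) eq)) (v-cong (forth 1 k 1≤n))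
      go-v k b₄    eq = trans (mate-v-at (k + (n ∸ 1)) (b₄-back₁ k eq)) (v-cong (back 1 k 1≤n))

    mate-sym : ∀ {x y} → mate x ≡ y → mate y ≡ x
    mate-sym {x} eq = trans (cong mate (sym eq)) (mate-involutive x)

    mate-adj : ∀ x → Adj x (mate x)
    mate-adj = vertex-elim (λ x → Adj x (mate x))
      (λ k → subst (Adj (u k)) (sym (mate-u k)) (go-u k (p k)))
      (λ k → subst (Adj (v k)) (sym (mate-v k)) (go-v k (p k)))
      where
      uu⁻ : ∀ k → Adj (u k) (u (k + (n ∸ 2)))
      uu⁻ k = symmetric (subst (Adj (u (k + (n ∸ 2)))) (u-cong (back 2 k 2≤n)) (uu⁺ (k + (n ∸ 2))))
      vv⁻ : ∀ k → Adj (v k) (v (k + (n ∸ 1)))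
      vv⁻ k = symmetric (subst (Adj (v (k + (n ∸ 1)))) (v-cong (back 1 k 1≤n)) (vv⁺ (k + (n ∸ 1))))
      go-u : ∀ k x → Adj (u k) (uMate x k)
      go-u k spoke = inj₁ (uv k)
      go-u k b₁    = uu⁺ k
      go-u k b₂    = uu⁺ k
      go-u k b₃    = uu⁻ k
      go-u k b₄    = uu⁻ k
      go-v : ∀ k x → Adj (v k) (vMate x k)
      go-v k spoke = inj₂ (uv k)
      go-v k b₁    = vv⁺ k
      go-v k b₂    = vv⁻ k
      go-v k b₃    = vv⁺ k
      go-v k b₄    = vv⁻ k

    matching : PerfectMatching P
    matching = record
      { edge     = λ x y → ⌊ mate x ≟ᵥ y ⌋
      ; edge-sym = λ x y → T-⇔⇒≡ (λ e → fromWitness (mate-sym (toWitness e))) (λ e → fromWitness (mate-sym (toWitness e)))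
      ; edge⇒Adj = λ x y e → subst (Adj x) (toWitness e) (mate-adj x)
      ; perfect  = λ x → mate x , fromWitness refl , toWitness
      }

    mate⇒edge : ∀ x {y} → mate x ≡ y → T (edge matching x y)
    mate⇒edge x = fromWitness

    edge⇒mate : ∀ x {y} → T (edge matching x y) → mate x ≡ y
    edge⇒mate x = toWitness

    -- A vertex has only one mate, so a list of mated pairs that meets every vertex cannot miss an
    -- edge.
    edgeSetIs-mates : ∀ {es} → (∀ {x y} → (x , y) ∈ es → mate x ≡ y) →
                      (∀ x → ∃[ y ] ((x , y) ∈ es ⊎ (y , x) ∈ es)) → EdgeSetIs matching es
    edgeSetIs-mates {es} mates cover x y = mk⇔ to (mate⇒edge x ∘ sound)
      where
      sound : ∀ {x y} → (x , y) ∈ es ⊎ (y , x) ∈ es → mate x ≡ y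
      sound (inj₁ e) = mates e
      sound (inj₂ e) = mate-sym (mates e)
      to : T (edge matching x y) → (x , y) ∈ es ⊎ (y , x) ∈ es
      to e with z , c ← cover x =
        subst (λ y → (x , y) ∈ es ⊎ (y , x) ∈ es) (trans (sym (sound c)) (edge⇒mate x e)) c

    spoke⇒phase : ∀ k → Spoke matching k → p k ≡ spoke
    spoke⇒phase k e = go (p k) (trans (sym (mate-u k)) (edge⇒mate (u k) e))
      where
      go : ∀ x → uMate x k ≡ v k → x ≡ spoke
      go spoke _ = refl
      go b₁ ()
      go b₂ ()
      go b₃ ()
      go b₄ ()

    phase⇒spoke : ∀ k → p k ≡ spoke → Spoke matching k
    phase⇒spoke k eq = mate⇒edge (u k) (mate-u-at k eq)

    -- A perfect matching contained in another is equal to it, so one inclusion suffices.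
    ≈-matching : (M : PerfectMatching P) → (∀ x → T (edge M x (mate x))) → matching ≈ₘ M
    ≈-matching M realizes x y = T-⇔⇒≡
      (λ e → subst (T ∘ edge M x) (edge⇒mate x e) (realizes x))
      (λ e → mate⇒edge x (trans (sym (proj₂ (proj₂ (perfect M x)) (realizes x))) (proj₂ (proj₂ (perfect M x)) e)))

  edgeSetIs-unique : ∀ (M M′ : PerfectMatching P) {es} → EdgeSetIs M es → EdgeSetIs M′ es → M ≈ₘ M′
  edgeSetIs-unique M M′ eq eq′ x y = T-⇔⇒≡
    (λ e → Equivalence.from (eq′ x y) (Equivalence.to (eq x y) e))
    (λ e → Equivalence.from (eq x y) (Equivalence.to (eq′ x y) e))

  -- The mate of `u k` separates the spoke, the first half and the second half of a block; the mate
  -- of `v k` separates the two cells within each half. Comparing directions presupposes that the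
  -- two neighbours at distance 2, and those at distance 1, are distinct.
  matching-injective : n ≢ 4 → ∀ {p q} (wp : Walk p) (pp : Periodic n p) (wq : Walk q) (pq : Periodic n q) →
    CyclicWalk.matching wp pp ≈ₘ CyclicWalk.matching wq pq → ∀ k → p k ≡ q k
  matching-injective n≢4 {p} {q} wp pp wq pq eq k =
    phases (p k) (q k) (trans (sym (A.mate-u k)) (trans (same (u k)) (B.mate-u k)))
                       (trans (sym (A.mate-v k)) (trans (same (v k)) (B.mate-v k)))
    where
    module A = CyclicWalk wp pp
    module B = CyclicWalk wq pq
    same : ∀ x → A.mate x ≡ B.mate x
    same x = sym (B.edge⇒mate x (subst T (eq x (A.mate x)) (A.mate⇒edge x refl)))
    u-clash : u (2 + k) ≢ u (k + (n ∸ 2))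
    u-clash e = k≁4+k n≢4 k (sym (trans (~-+ 2 (u-injective e)) (back 2 k 2≤n)))
    v-clash : v (1 + k) ≢ v (k + (n ∸ 1))
    v-clash e = k≁2+k k (sym (trans (~-+ 1 (v-injective e)) (back 1 k 1≤n)))
    phases : ∀ x y → uMate x k ≡ uMate y k → vMate x k ≡ vMate y k → x ≡ y
    phases spoke spoke _ _ = refl
    phases spoke b₁ () _
    phases spoke b₂ () _
    phases spoke b₃ () _
    phases spoke b₄ () _
    phases b₁ spoke () _
    phases b₁ b₁ _ _ = refl
    phases b₁ b₂ _ e = contradiction e v-clash
    phases b₁ b₃ e _ = contradiction e u-clash
    phases b₁ b₄ e _ = contradiction e u-clash
    phases b₂ spoke () _
    phases b₂ b₁ _ e = contradiction (sym e) v-clash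
    phases b₂ b₂ _ _ = refl
    phases b₂ b₃ e _ = contradiction e u-clash
    phases b₂ b₄ e _ = contradiction e u-clash
    phases b₃ spoke () _
    phases b₃ b₁ e _ = contradiction (sym e) u-clash
    phases b₃ b₂ e _ = contradiction (sym e) u-clash
    phases b₃ b₃ _ _ = refl
    phases b₃ b₄ _ e = contradiction e v-clash
    phases b₄ spoke () _
    phases b₄ b₁ e _ = contradiction (sym e) u-clash
    phases b₄ b₂ e _ = contradiction (sym e) u-clash
    phases b₄ b₃ _ e = contradiction (sym e) v-clash
    phases b₄ b₄ _ _ = refl

  -- The spokeless pattern and membership of the constructed matchings

  blockEdges : ℕ → ℕ → List (Vertex n × Vertex n)
  blockEdges i k = (u (i + 4 * k)     , u (i + 4 * k + 2)) ∷
                   (u (i + 4 * k + 1) , u (i + 4 * k + 3)) ∷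
                   (v (i + 4 * k)     , v (i + 4 * k + 1)) ∷
                   (v (i + 4 * k + 2) , v (i + 4 * k + 3)) ∷ []

  spokelessEdges : ℕ → List (Vertex n × Vertex n)
  spokelessEdges i = concatMap (blockEdges i) (upTo (n div 4))

  locate : 4 ∣ n → ∀ i j → ∃[ k ] ∃[ s ] (k < n div 4 × s < 4 × i + 4 * k + s ~ j)
  locate (divides m n≡m*4) i j = t div 4 , t % 4 , subst (t div 4 <_) (sym n/4≡m) (m<n*o⇒m/o<n t<) , m%n<n t 4 , position
    where
    -- This is j - i modulo n; its quotient by 4 gives the block and its remainder the cell.
    t = (j + i * (n ∸ 1)) % n
    n/4≡m : n div 4 ≡ m
    n/4≡m = trans (cong (_div 4) n≡m*4) (m*n/n≡m m 4)
    t< : t < m * 4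
    t< = subst (t <_) n≡m*4 (m%n<n (j + i * (n ∸ 1)) n)
    swap : ∀ i a b → i + 4 * a + b ≡ i + (b + a * 4)
    swap = solve-∀
    position : i + 4 * (t div 4) + t % 4 ~ j
    position = begin
      (i + 4 * (t div 4) + t % 4) % n    ≡⟨ cong (_% n) (swap i (t div 4) (t % 4)) ⟩
      (i + (t % 4 + t div 4 * 4)) % n    ≡⟨ cong (λ x → (i + x) % n) (m≡m%n+[m/n]*n t 4) ⟨
      (i + t) % n                        ≡⟨ ~-+ i (m%n%n≡m%n (j + i * (n ∸ 1)) n) ⟩
      (i + (j + i * (n ∸ 1))) % n        ≡⟨ cong (_% n) (+-comm i (j + i * (n ∸ 1))) ⟩
      (j + i * (n ∸ 1) + i) % n          ≡⟨ +-complement j i ⟩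
      j % n                              ∎
      where open ≡-Reasoning

  spokelessEdges-cover : 4 ∣ n → ∀ i x → ∃[ y ] ((x , y) ∈ spokelessEdges i ⊎ (y , x) ∈ spokelessEdges i)
  spokelessEdges-cover 4∣n i = vertex-elim (λ x → ∃[ y ] Covered x y)
    (λ j → let k , s , k< , s< , eq = locate 4∣n i j in subst (λ x → ∃[ y ] Covered x y) (u-cong eq) (go-u k k< s s<))
    (λ j → let k , s , k< , s< , eq = locate 4∣n i j in subst (λ x → ∃[ y ] Covered x y) (v-cong eq) (go-v k k< s s<))
    where
    Covered : Vertex n → Vertex n → Set
    Covered x y = (x , y) ∈ spokelessEdges i ⊎ (y , x) ∈ spokelessEdges i
    member : ∀ {k e} → k < n div 4 → e ∈ blockEdges i k → e ∈ spokelessEdges i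
    member k< e∈ = ∈-concatMap⁺ (blockEdges i) (lose (∈-upTo⁺ k<) e∈)
    here₀ : ∀ (w : ℕ → Vertex n) k {y} → (w (i + 4 * k) , y) ∈ blockEdges i k → (w (i + 4 * k + 0) , y) ∈ blockEdges i k
    here₀ w k {y} = subst (λ a → (w a , y) ∈ blockEdges i k) (sym (+-identityʳ (i + 4 * k)))
    go-u : ∀ k → k < n div 4 → ∀ s → s < 4 → ∃[ y ] Covered (u (i + 4 * k + s)) y
    go-u k k< 0 _ = _ , inj₁ (member k< (here₀ u k (here refl)))
    go-u k k< 1 _ = _ , inj₁ (member k< (there (here refl)))
    go-u k k< 2 _ = _ , inj₂ (member k< (here refl))
    go-u k k< 3 _ = _ , inj₂ (member k< (there (here refl)))
    go-u k k< (suc (suc (suc (suc _)))) (s≤s (s≤s (s≤s (s≤s ()))))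
    go-v : ∀ k → k < n div 4 → ∀ s → s < 4 → ∃[ y ] Covered (v (i + 4 * k + s)) y
    go-v k k< 0 _ = _ , inj₁ (member k< (here₀ v k (there (there (here refl)))))
    go-v k k< 1 _ = _ , inj₂ (member k< (there (there (here refl))))
    go-v k k< 2 _ = _ , inj₁ (member k< (there (there (there (here refl)))))
    go-v k k< 3 _ = _ , inj₂ (member k< (there (there (there (here refl)))))
    go-v k k< (suc (suc (suc (suc _)))) (s≤s (s≤s (s≤s (s≤s ()))))

  module CyclicMembership {p : ℕ → Phase} (walk : Walk p) (periodic : Periodic n p) where
    open CyclicWalk walk periodic

    spokeless-edgeSet : 4 ∣ n → ∀ i → (∀ k → p (k + i) ≡ blockPhase k) → EdgeSetIs matching (spokelessEdges i)
    spokeless-edgeSet 4∣n i phases = edgeSetIs-mates mates (spokelessEdges-cover 4∣n i)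
      where
      phase : ∀ k s → p (i + 4 * k + s) ≡ blockPhase s
      phase k s = trans (cong p (swap i k s)) (trans (phases (s + k * 4)) (blockPhase-+4 s k))
        where
        swap : ∀ i k s → i + 4 * k + s ≡ s + k * 4 + i
        swap = solve-∀
      phase₀ : ∀ k → p (i + 4 * k) ≡ b₁
      phase₀ k = trans (cong p (sym (+-identityʳ (i + 4 * k)))) (phase k 0)
      go : ∀ k {x y} → (x , y) ∈ blockEdges i k → mate x ≡ y
      go k (here refl) = trans (mate-u-at (i + 4 * k) (phase₀ k)) (cong u (+-comm 2 (i + 4 * k)))
      go k (there (here refl)) = trans (mate-u-at (i + 4 * k + 1) (phase k 1)) (cong u (lemma (i + 4 * k)))
        where
        lemma : ∀ a → 2 + (a + 1) ≡ a + 3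
        lemma = solve-∀
      go k (there (there (here refl))) = trans (mate-v-at (i + 4 * k) (phase₀ k)) (cong v (+-comm 1 (i + 4 * k)))
      go k (there (there (there (here refl)))) = trans (mate-v-at (i + 4 * k + 2) (phase k 2)) (cong v (lemma (i + 4 * k)))
        where
        lemma : ∀ a → 1 + (a + 2) ≡ a + 3
        lemma = solve-∀
      mates : ∀ {x y} → (x , y) ∈ spokelessEdges i → mate x ≡ y
      mates e with k , _ , e∈ ← find (∈-concatMap⁻ (blockEdges i) {xs = upTo (n div 4)} e) = go k e∈

    matching-spaced : ∀ i → p i ≡ spoke → SpokesSpacedBy4 matching
    matching-spaced i pi = (i , phase⇒spoke i pi) , spaced
      where
      spaced : ∀ i j → Consecutive matching i j → 4 ∣ (j ∸ i ∸ 1)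
      spaced i j (i<j , _ , si , sj , none) with g , refl ← m≤n⇒∃[o]m+o≡n i<j =
        subst (4 ∣_) (sym gap) (spokeGap walk i g (spoke⇒phase i si)
          (trans (cong p (cong suc (+-comm g i))) (spoke⇒phase (suc i + g) sj))
          λ k i<k k<j → none k i<k (subst (k <_) (cong suc (+-comm g i)) k<j) ∘ phase⇒spoke k)
        where
        gap : suc i + g ∸ i ∸ 1 ≡ g
        gap = cong (_∸ 1) (trans (cong (_∸ i) (sym (+-suc i g))) (m+n∸m≡n i (suc g)))

    matching-spokeless : (∀ k → p k ≢ spoke) → SpokelessPattern matching
    matching-spokeless none with i , pi ← spokeless-start walk none =
      (λ k → none k ∘ spoke⇒phase k) , 4∣n , i , spokeless-edgeSet 4∣n i (spokeless-blockPhase walk none i pi)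
      where
      4∣n = spokeless-4∣period walk none periodic

    matching-∈𝓜₁ : n ≢ 4 → In𝓜₁ matching
    matching-∈𝓜₁ n≢4 with anyUpTo? (λ k → spoke? (p k)) n
    ... | yes (i , _ , pi) = inj₁ (n≢4 , inj₁ (matching-spaced i pi))
    ... | no  none         = inj₁ (n≢4 , inj₂ (matching-spokeless λ k pk →
                               none (k % n , m%n<n k n , trans (periodic-% periodic k) pk)))

  Realized : PerfectMatching P → Set
  Realized M = ∃[ p ] ∃[ walk ] ∃[ periodic ] CyclicWalk.matching {p} walk periodic ≈ₘ M

  spokeless-realized : ∀ M → SpokelessPattern M → Realized M
  spokeless-realized M (_ , 4∣n@(divides m n≡m*4) , i , edges) = p , walk , periodic ,
    edgeSetIs-unique (CyclicWalk.matching walk periodic) M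
      (CyclicMembership.spokeless-edgeSet walk periodic 4∣n i phases) edges
    where
    -- The block sequence moved to begin at i, again with `i * (n ∸ 1)` for -i. That 4 divides n
    -- makes it n-periodic.
    p : ℕ → Phase
    p k = blockPhase (k + i * (n ∸ 1))
    blockPhase-periodic : Periodic n blockPhase
    blockPhase-periodic k = trans (cong (λ x → blockPhase (k + x)) n≡m*4) (blockPhase-+4 k m)
    walk : Walk p
    walk k = blockPhase-walk (k + i * (n ∸ 1))
    periodic : Periodic n p
    periodic k = trans (cong blockPhase (xy∙z≈xz∙y k n (i * (n ∸ 1)))) (blockPhase-periodic (k + i * (n ∸ 1)))
    phases : ∀ k → p (k + i) ≡ blockPhase k
    phases k = trans (cong blockPhase (xy∙z≈x∙zy k i (i * (n ∸ 1))))
      (trans (cong (λ x → blockPhase (k + x)) (complement i)) (periodic-* blockPhase-periodic i k))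

  -- The tiling of a matching

  module Adjacency (M : PerfectMatching P) where

    Along Around : ℕ → Set
    Along k = T (edge M (v k) (v (1 + k)))
    Around k = T (edge M (u k) (u (2 + k)))

    Spoke-cong : ∀ {i j} → i ~ j → Spoke M i → Spoke M j
    Spoke-cong eq = subst₂ (λ x y → T (edge M x y)) (u-cong eq) (v-cong eq)

    Along-cong : ∀ {i j} → i ~ j → Along i → Along j
    Along-cong eq = subst₂ (λ x y → T (edge M x y)) (v-cong eq) (v-cong (~-+ 1 eq))

    Around-cong : ∀ {i j} → i ~ j → Around i → Around j
    Around-cong eq = subst₂ (λ x y → T (edge M x y)) (u-cong eq) (u-cong (~-+ 2 eq))

    reverse : ∀ {x y} → T (edge M x y) → T (edge M y x)
    reverse {x} {y} = subst T (edge-sym M x y)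

    unique : ∀ {x y z} → T (edge M x y) → T (edge M x z) → y ≡ z
    unique {x} e e′ = trans (sym (proj₂ (proj₂ (perfect M x)) e)) (proj₂ (proj₂ (perfect M x)) e′)

    around-or-back : ∀ k → ¬ Spoke M (2 + k) → Around k ⊎ Around (2 + k)
    around-or-back k ¬s with y , e , _ ← perfect M (u (2 + k)) with adj-u (2 + k) refl (edge⇒Adj M _ _ e)
    ... | inj₁ refl = contradiction e ¬s
    ... | inj₂ (inj₁ refl) = inj₂ e
    ... | inj₂ (inj₂ (j , refl , eq)) =
      inj₁ (reverse (subst (λ z → T (edge M (u (2 + k)) z)) (u-cong (~-cancel 2 eq)) e))

    along-or-back : ∀ k → ¬ Spoke M (1 + k) → Along k ⊎ Along (1 + k)
    along-or-back k ¬s with y , e , _ ← perfect M (v (1 + k)) with adj-v (1 + k) refl (edge⇒Adj M _ _ e)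
    ... | inj₁ refl = contradiction (reverse e) ¬s
    ... | inj₂ (inj₁ refl) = inj₂ e
    ... | inj₂ (inj₂ (j , refl , eq)) =
      inj₁ (reverse (subst (λ z → T (edge M (v (1 + k)) z)) (v-cong (~-cancel 1 eq)) e))

    spoke⇒¬around : ∀ k → Spoke M k → ¬ Around k
    spoke⇒¬around k s a with () ← unique s a

    spoke⇒¬around-back : ∀ k → Spoke M (2 + k) → ¬ Around k
    spoke⇒¬around-back k s a with () ← unique s (reverse a)

    spoke⇒¬along : ∀ k → Spoke M k → ¬ Along k
    spoke⇒¬along k s a with () ← unique (reverse s) a

    along⇒¬along : ∀ k → Along k → ¬ Along (1 + k)
    along⇒¬along k a a′ = k≁2+k k (v-injective (unique (reverse a) a′))

    around⇒¬around : n ≢ 4 → ∀ k → Around k → ¬ Around (2 + k)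
    around⇒¬around n≢4 k a a′ = k≁4+k n≢4 k (u-injective (unique (reverse a) a′))

    -- Each edge is recorded only at its first endpoint, hence nothing at `b₄`. The second endpoints
    -- are recovered in `fits-realized` by stepping back along the walk.
    Fits : Phase → ℕ → Set
    Fits spoke k = Spoke M k
    Fits b₁    k = Along k × Around k
    Fits b₂    k = Around k
    Fits b₃    k = Along k
    Fits b₄    k = ⊤

    Fits-cong : ∀ x {i j} → i ~ j → Fits x i → Fits x j
    Fits-cong spoke eq s       = Spoke-cong eq s
    Fits-cong b₁    eq (a , b) = Along-cong eq a , Around-cong eq b
    Fits-cong b₂    eq a       = Around-cong eq a
    Fits-cong b₃    eq a       = Along-cong eq a
    Fits-cong b₄    eq _       = tt

    fits-realized : ∀ {p} (walk : Walk p) (periodic : Periodic n p) → (∀ k → Fits (p k) k) → Realized M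
    fits-realized {p} walk periodic fits = p , walk , periodic , ≈-matching M
      (vertex-elim (λ x → T (edge M x (mate x)))
        (λ k → subst (λ y → T (edge M (u k) y)) (sym (mate-u k)) (go-u k (p k) refl))
        (λ k → subst (λ y → T (edge M (v k) y)) (sym (mate-v k)) (go-v k (p k) refl)))
      where
      open CyclicWalk walk periodic
      fits-at : ∀ k {x} → p k ≡ x → Fits x k
      fits-at k refl = fits k
      around⁻ : ∀ k → Around (k + (n ∸ 2)) → T (edge M (u k) (u (k + (n ∸ 2))))
      around⁻ k a = reverse (subst (λ y → T (edge M (u (k + (n ∸ 2))) y)) (u-cong (back 2 k 2≤n)) a)
      along⁻ : ∀ k → Along (k + (n ∸ 1)) → T (edge M (v k) (v (k + (n ∸ 1))))
      along⁻ k a = reverse (subst (λ y → T (edge M (v (k + (n ∸ 1))) y)) (v-cong (back 1 k 1≤n)) a)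
      go-u : ∀ k x → p k ≡ x → T (edge M (u k) (uMate x k))
      go-u k spoke eq = fits-at k eq
      go-u k b₁    eq = proj₂ (fits-at k eq)
      go-u k b₂    eq = fits-at k eq
      go-u k b₃    eq = around⁻ k (proj₂ (fits-at (k + (n ∸ 2)) (b₃-back₂ k eq)))
      go-u k b₄    eq = around⁻ k (fits-at (k + (n ∸ 2)) (b₄-back₂ k eq))
      go-v : ∀ k x → p k ≡ x → T (edge M (v k) (vMate x k))
      go-v k spoke eq = reverse (fits-at k eq)
      go-v k b₁    eq = proj₁ (fits-at k eq)
      go-v k b₂    eq = along⁻ k (proj₁ (fits-at (k + (n ∸ 1)) (b₂-back₁ k eq)))
      go-v k b₃    eq = fits-at k eq
      go-v k b₄    eq = along⁻ k (fits-at (k + (n ∸ 1)) (b₄-back₁ k eq))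

  -- Matchings whose spokes have gaps divisible by 4

  module Spaced (n≢4 : n ≢ 4) (M : PerfectMatching P) (spaced : SpokesSpacedBy4 M) where
    open Adjacency M

    i₀ : ℕ
    i₀ = proj₁ (proj₁ spaced)

    -- i₀ + k modulo n, written as a successor because Forward refers to the index before it.
    pos : ℕ → ℕ
    pos k = suc (k + (i₀ + (n ∸ 1)))

    pos-~ : ∀ k → pos k ~ k + i₀
    pos-~ k = trans (cong (_% n) (sym (+-suc k (i₀ + (n ∸ 1))))) (~-+ k (back 1 i₀ 1≤n))

    isSpoke : ℕ → Bool
    isSpoke k = edge M (u k) (v k)

    -- The only candidate, since the spokes determine the phases between them. Starting at a known
    -- spoke leaves no initial phase to guess; that the steps onto later spokes are legal is where
    -- the spacing is used.
    q : ℕ → Phase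
    q zero    = spoke
    q (suc k) = advance (isSpoke (pos (suc k))) (q k)

    spoke-q : ∀ k → Spoke M (pos k) → q k ≡ spoke
    spoke-q zero    _ = refl
    spoke-q (suc k) s = advance-spoke (isSpoke (pos (suc k))) s

    q-spoke : ∀ k → q k ≡ spoke → Spoke M (pos k)
    q-spoke zero    _  = Spoke-cong (sym (pos-~ 0)) (proj₂ (proj₁ spaced))
    q-spoke (suc k) eq = spoke-advance (isSpoke (pos (suc k))) eq

    -- The last spoke is carried along because the spacing hypothesis, applied when the next one
    -- appears, speaks of both ends of a gap.
    LastSpoke : ℕ → Set
    LastSpoke k = ∃[ i ] ∃[ g ] (i + g ≡ pos k × Spoke M i ×
      (∀ j → i < j → j ≤ pos k → ¬ Spoke M j) × q k ≡ afterSpoke g)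

    lastSpoke-here : ∀ k → q k ≡ spoke → LastSpoke k
    lastSpoke-here k eq =
      pos k , 0 , +-identityʳ (pos k) , q-spoke k eq , (λ j i<j j≤i → contradiction j≤i (<⇒≱ i<j)) , eq

    lastSpoke : ∀ k → LastSpoke k
    lastSpoke zero    = lastSpoke-here 0 refl
    lastSpoke (suc k) with spoke? (q (suc k)) | lastSpoke k
    ... | yes eq | _ = lastSpoke-here (suc k) eq
    ... | no ≢spoke | i , g , i+g , s , none , after =
      i , suc g , trans (+-suc i g) (cong suc i+g) , s , none′ ,
      trans (advance-next (isSpoke (pos (suc k))) (≢spoke ∘ spoke-q (suc k)))
            (trans (cong next after) (sym (afterSpoke-suc g)))
      where
      none′ : ∀ j → i < j → j ≤ pos (suc k) → ¬ Spoke M j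
      none′ j i<j j≤ with m≤n⇒m<n∨m≡n j≤
      ... | inj₁ (s≤s j≤′) = none j i<j j≤′
      ... | inj₂ refl      = ≢spoke ∘ spoke-q (suc k)

    walk : Walk q
    walk k = step-advance (isSpoke (pos (suc k))) (q k) (end (lastSpoke k))
      where
      end : LastSpoke k → Spoke M (pos (suc k)) → Step (q k) spoke
      end (i , g , i+g , s , none , after) s′ = subst (λ x → Step x spoke) (sym after)
        (afterSpoke-step-spoke g (subst (4 ∣_) gap (proj₂ spaced i (pos (suc k))
          (i<j , j≤i+n , s , s′ , λ l i<l l<j → none l i<l (s≤s⁻¹ l<j)))))
        where
        i<j : i < pos (suc k)
        i<j = s≤s (≤-trans (m≤m+n i g) (≤-reflexive i+g))
        -- The index i + n carries the same spoke as i, so the next spoke cannot lie beyond it.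
        j≤i+n : pos (suc k) ≤ i + n
        j≤i+n = ≮⇒≥ λ i+n<j → none (i + n) (m<m+n i 1≤n) (s≤s⁻¹ i+n<j) (Spoke-cong (sym ([m+n]%n≡m%n i n)) s)
        gap : pos (suc k) ∸ i ∸ 1 ≡ g
        gap = trans (cong (λ x → suc x ∸ i ∸ 1) (sym i+g))
          (cong (_∸ 1) (trans (cong (_∸ i) (sym (+-suc i g))) (m+n∸m≡n i (suc g))))

    -- After one lap the automaton is back at the spoke of `i₀`, in its initial phase, and from
    -- there reads the same spokes again.
    periodic : Periodic n q
    periodic zero    = spoke-q n (Spoke-cong
      (trans (sym ([m+n]%n≡m%n (pos 0) n)) (cong (_% n) (cong suc (+-comm (i₀ + (n ∸ 1)) n))))
      (q-spoke 0 refl))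
    periodic (suc k) = cong₂ advance (cong₂ (edge M) (u-cong same) (v-cong same)) (periodic k)
      where
      lemma : ∀ k n a → suc (suc (k + n + a)) ≡ suc (suc k + a) + n
      lemma = solve-∀
      same : pos (suc k + n) ~ pos (suc k)
      same = trans (cong (_% n) (lemma k n (i₀ + (n ∸ 1)))) ([m+n]%n≡m%n (pos (suc k)) n)

    -- What a spoke further back forces near the index 1 + k when that index has the
    -- given phase.
    Forward : Phase → ℕ → Set
    Forward spoke k = Spoke M (1 + k)
    Forward b₁    k = Along (1 + k) × ¬ Around k
    Forward b₂    k = ¬ Along (1 + k) × Around (1 + k)
    Forward b₃    k = Along (1 + k) × Around k
    Forward b₄    k = ¬ Along (1 + k) × ¬ Around (1 + k)

    along-next : ∀ k → ¬ Along k → ¬ Spoke M (1 + k) → Along (1 + k)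
    along-next k ¬a ¬s = fromInj₂ (⊥-elim ∘ ¬a) (along-or-back k ¬s)

    around-next : ∀ k → ¬ Around k → ¬ Spoke M (2 + k) → Around (2 + k)
    around-next k ¬a ¬s = fromInj₂ (⊥-elim ∘ ¬a) (around-or-back k ¬s)

    -- An absent edge forces the next one and a present edge excludes it. For the `u`-edges this
    -- links indices at distance 2: the absence noted at `b₁` forces the edge starting at `b₂`,
    -- which `b₃` remembers and which excludes one starting at `b₄`.
    forward-step : ∀ {x y} k → Step x y → (y ≡ spoke → Spoke M (2 + k)) → (Spoke M (2 + k) → y ≡ spoke) →
                   Forward x k → Forward y (1 + k)
    forward-step k spoke-spoke s _  _        = s refl
    forward-step k b₄-spoke    s _  _        = s refl
    forward-step k spoke-b₁    _ ¬s f        =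
      along-next (1 + k) (spoke⇒¬along (1 + k) f) (λ t → contradiction (¬s t) λ ()) , spoke⇒¬around (1 + k) f
    forward-step k b₄-b₁       _ ¬s (f , g)  =
      along-next (1 + k) f (λ t → contradiction (¬s t) λ ()) , g
    forward-step k b₁-b₂       _ ¬s (f , g)  =
      along⇒¬along (1 + k) f , around-next k g (λ t → contradiction (¬s t) λ ())
    forward-step k b₂-b₃       _ ¬s (f , g)  =
      along-next (1 + k) f (λ t → contradiction (¬s t) λ ()) , g
    forward-step k b₃-b₄       _ ¬s (f , g)  =
      along⇒¬along (1 + k) f , around⇒¬around n≢4 k g

    forward : ∀ k → Forward (q k) (k + (i₀ + (n ∸ 1)))
    forward zero    = q-spoke 0 refl
    forward (suc k) = forward-step _ (walk k) (q-spoke (suc k)) (spoke-q (suc k)) (forward k)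

    -- Induction on the distance d to a later spoke.
    backward : ∀ d k → q (d + k) ≡ spoke →
               (q k ≡ b₁ → Around (pos k)) × (q k ≡ b₃ → ¬ Around (pos k))
    backward zero k s = (λ eq → contradiction (trans (sym eq) s) λ ()) , (λ eq → contradiction (trans (sym eq) s) λ ())
    backward (suc zero) k s =
      (λ eq → contradiction (trans (sym (after-b₁ (walk k) eq)) s) λ ()) ,
      (λ eq → contradiction (trans (sym (after-b₃ (walk k) eq)) s) λ ())
    -- Indices two apart share a `u`-vertex, so the induction descends by 2 and `b₁` and `b₃`
    -- determine each other. It is anchored where a spoke stands two after a `b₃`, for a spoke
    -- admits no `u`-edge. At distances 0 and 1 from a spoke neither phase occurs.
    backward (suc (suc d)) k s
      with IH₁ , IH₃ ← backward d (2 + k) (trans (cong q (trans (+-suc d (suc k)) (cong suc (+-suc d k)))) s) =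
      on-b₁ , on-b₃
      where
      on-b₁ : q k ≡ b₁ → Around (pos k)
      on-b₁ eq = fromInj₁ (⊥-elim ∘ IH₃ b₃-at)
        (around-or-back (pos k) λ t → contradiction (trans (sym b₃-at) (spoke-q (2 + k) t)) λ ())
        where
        b₃-at : q (2 + k) ≡ b₃
        b₃-at = after-b₂ (walk (1 + k)) (after-b₁ (walk k) eq)
      on-b₃ : q k ≡ b₃ → ¬ Around (pos k)
      on-b₃ eq = go (q (2 + k)) refl (start-after-b₄ (subst (λ x → Step x (q (2 + k))) (after-b₃ (walk k) eq) (walk (1 + k))))
        where
        go : ∀ x → q (2 + k) ≡ x → Start x → ¬ Around (pos k)
        go _ e start-spoke   = spoke⇒¬around-back (pos k) (q-spoke (2 + k) e)
        go _ e start-b₁    a = around⇒¬around n≢4 (pos k) a (IH₁ e)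

    fits : ∀ k → Fits (q k) (pos k)
    fits k = go (q k) refl (forward k)
      where
      -- The distance k(n - 1) leads from k to kn, a whole number of laps after the spoke at 0.
      spoke-later : q (k * (n ∸ 1) + k) ≡ spoke
      spoke-later = trans (cong q (complement k)) (periodic-* {n} {q} periodic k 0)
      go : ∀ x → q k ≡ x → Forward x (k + (i₀ + (n ∸ 1))) → Fits x (pos k)
      go spoke _  f       = f
      go b₁    eq (f , _) = f , proj₁ (backward (k * (n ∸ 1)) k spoke-later) eq
      go b₂    _  (_ , f) = f
      go b₃    _  (f , _) = f
      go b₄    _  _       = tt

    realized : Realized M
    realized = fits-realized
      -- The walk `q` counts from `i₀`; subtracting `i₀` returns to the subscripts of the graph.
      (λ k → walk (k + i₀ * (n ∸ 1)))
      (λ k → trans (cong q (xy∙z≈xz∙y k n (i₀ * (n ∸ 1)))) (periodic (k + i₀ * (n ∸ 1))))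
      (λ k → Fits-cong (q (k + i₀ * (n ∸ 1))) (trans (pos-~ (k + i₀ * (n ∸ 1))) (+-complement k i₀)) (fits (k + i₀ * (n ∸ 1))))

  𝓜₁-realized : n ≢ 4 → ∀ M → In𝓜₁ M → Realized M
  𝓜₁-realized n≢4 M (inj₁ (_ , inj₁ spaced))    = Spaced.realized n≢4 M spaced
  𝓜₁-realized n≢4 M (inj₁ (_ , inj₂ spokeless)) = spokeless-realized M spokeless
  𝓜₁-realized n≢4 M (inj₂ (n≡4 , _))            = contradiction n≡4 n≢4

  matching-cong : ∀ {p r} (wp : Walk p) (pp : Periodic n p) (wr : Walk r) (pr : Periodic n r) →
    (∀ k → p k ≡ r k) → CyclicWalk.matching wp pp ≈ₘ CyclicWalk.matching wr pr
  matching-cong wp pp wr pr eq = A.≈-matching B.matching λ x → B.mate⇒edge x (same x)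
    where
    module A = CyclicWalk wp pp
    module B = CyclicWalk wr pr
    same : ∀ x → B.mate x ≡ A.mate x
    same (u′ a) = cong (λ x → uMate x (toℕ a)) (sym (eq (toℕ a)))
    same (v′ a) = cong (λ x → vMate x (toℕ a)) (sym (eq (toℕ a)))

-- Cardinality for n other than 4

hasCardinality : ∀ {c ℓ} (S : Setoid c ℓ) {A : Set} {N : ℕ} → let open Setoid S in
  (f : A → Carrier) → (∀ {a b} → f a ≈ f b → a ≡ b) → (∀ x → ∃[ a ] f a ≈ x) →
  A ↔ Fin N → HasCardinality S N
hasCardinality S {A} f injective surjective A↔Fin = record
  { to        = λ x → I.to (index x)
  ; from      = λ i → f (I.from i)
  -- The preimages chosen by surjectivity respect equality because f reflects it.
  ; to-cong   = λ {x} {y} x≈y → cong I.to (injective (trans′ (f-index x) (trans′ x≈y (sym′ (f-index y)))))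
  ; from-cong = λ { refl → refl′ }
  ; inverse   = (λ {i} {x} x≈ → trans (cong I.to (injective (trans′ (f-index x) x≈))) (I.strictlyInverseˡ i))
              , (λ { {x} refl → trans′ (reflexive (cong f (I.strictlyInverseʳ (index x)))) (f-index x) })
  }
  where
  open Setoid S renaming (refl to refl′; sym to sym′; trans to trans′)
  module I = Inverse A↔Fin
  index : Carrier → A
  index x = proj₁ (surjective x)
  f-index : ∀ x → f (index x) ≈ x
  f-index x = proj₂ (surjective x)

module _ (n : ℕ) (n≥3 : n ≥ 3) where
  open PetersenMatchings n n≥3

  𝓜₁-cardinality : n ≢ 4 → HasCardinality (𝓜₁ n n≥3) (#cyclic n)
  𝓜₁-cardinality n≢4 = hasCardinality (𝓜₁ n n≥3)
    (λ c → matching c , CyclicMembership.matching-∈𝓜₁ (walk c) (periodic c) n≢4)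
    (λ {c} {c′} eq → cyclicPhaseAt-injective c c′
      (matching-injective n≢4 (walk c) (periodic c) (walk c′) (periodic c′) eq))
    surjective
    (CyclicTiling↔Fin n)
    where
    walk : (c : CyclicTiling n) → Walk (cyclicPhaseAt c)
    walk = cyclicPhaseAt-walk
    periodic : (c : CyclicTiling n) → Periodic n (cyclicPhaseAt c)
    periodic = cyclicPhaseAt-periodic
    matching : CyclicTiling n → PerfectMatching (GeneralizedPetersen.P n n≥3)
    matching c = CyclicWalk.matching (walk c) (periodic c)
    surjective : ∀ M → ∃[ c ] (matching c ≈ₘ proj₁ M)
    surjective (M , M∈) with p , wp , pp , p≈M ← 𝓜₁-realized n≢4 M M∈
      with c , eq ← cyclicPhaseAt-surjective n≥3 wp pp =
      c , λ x y → trans (matching-cong (walk c) (periodic c) wp pp eq x y) (p≈M x y)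

-- The case n = 4

module _ (4≥3 : 4 ≥ 3) where
  open GeneralizedPetersen 4 4≥3 using (u; v)
  open PerfectMatching using (EdgeSetIs)
  open PetersenMatchings 4 4≥3

  module Spokes = CyclicWalk {λ _ → spoke} (λ _ → spoke-spoke) (λ _ → refl)
  module Blocks = CyclicWalk {blockPhase} blockPhase-walk (λ k → blockPhase-+4 k 1)

  spokes-edgeSet : EdgeSetIs Spokes.matching (map (λ i → (u i , v i)) (upTo 4))
  spokes-edgeSet = Spokes.edgeSetIs-mates
    (λ where
      (here refl)                         → refl
      (there (here refl))                 → refl
      (there (there (here refl)))         → refl
      (there (there (there (here refl)))) → refl
      (there (there (there (there ())))))
    (λ where
      (u′ 0F) → _ , inj₁ (here refl)
      (u′ 1F) → _ , inj₁ (there (here refl))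
      (u′ 2F) → _ , inj₁ (there (there (here refl)))
      (u′ 3F) → _ , inj₁ (there (there (there (here refl))))
      (v′ 0F) → _ , inj₂ (here refl)
      (v′ 1F) → _ , inj₂ (there (here refl))
      (v′ 2F) → _ , inj₂ (there (there (here refl)))
      (v′ 3F) → _ , inj₂ (there (there (there (here refl)))))

  -- For n = 4 the pattern has a single block, and with i = 0 it evaluates to the four edges of the
  -- second exceptional matching.
  blocks-edgeSet : EdgeSetIs Blocks.matching (spokelessEdges 0)
  blocks-edgeSet = CyclicMembership.spokeless-edgeSet blockPhase-walk (λ k → blockPhase-+4 k 1)
    (divides 1 refl) 0 (λ k → cong blockPhase (+-identityʳ k))

  𝓜₁-cardinality-4 : HasCardinality (𝓜₁ 4 4≥3) 2
  𝓜₁-cardinality-4 = hasCardinality (𝓜₁ 4 4≥3) {Fin 2}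
    (λ where
      0F → Spokes.matching , inj₂ (refl , inj₁ spokes-edgeSet)
      1F → Blocks.matching , inj₂ (refl , inj₂ blocks-edgeSet))
    injective
    (λ where
      (M , inj₁ (4≢4 , _))                → contradiction refl 4≢4
      (M , inj₂ (_ , inj₁ edges)) → 0F , edgeSetIs-unique Spokes.matching M spokes-edgeSet edges
      (M , inj₂ (_ , inj₂ edges)) → 1F , edgeSetIs-unique Blocks.matching M blocks-edgeSet edges)
    ↔-refl
    where
    injective : ∀ {a b : Fin 2} → _ → a ≡ b
    injective {0F} {0F} _  = refl
    injective {1F} {1F} _  = refl
    -- The spoke at 0 lies in one matching and not in the other.
    injective {0F} {1F} eq = contradiction (eq (u 0) (v 0)) λ ()
    injective {1F} {0F} eq = contradiction (eq (u 0) (v 0)) λ ()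

open import Data.Integer.Base using (+_)
open import Data.Rational.Base using (_/_)

theorem2p1 : ∀ (n : ℕ) (n≥3 : n ≥ 3) →
    ∃[ N ] (HasCardinality (𝓜₁ n n≥3) N × (+ N / 1 ≡ formula n n≥3))
theorem2p1 n n≥3 = by-cases n n≥3 (n ≟ 4)
  where
  by-cases : ∀ n (n≥3 : n ≥ 3) → Dec (n ≡ 4) →
    ∃[ N ] (HasCardinality (𝓜₁ n n≥3) N × (+ N / 1 ≡ formula n n≥3))
  by-cases _ n≥3 (yes refl) = 2 , 𝓜₁-cardinality-4 n≥3 , refl
  by-cases n n≥3 (no  n≢4)  = #cyclic n , 𝓜₁-cardinality n n≥3 n≢4 , sym (formula≡#cyclic n n≥3 n≢4)
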